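{- Let $\Gamma$ be the unique real number in $[1,2]$ satisfying $\Gamma^{ -4}+\Gamma^{ -5}+\Gamma^{ -6}=1$. Then: (a) If $K$ is any simplicial complex with $n$ vertices and $m$ maximal faces, then $\mathrm{b}(K)\leq \Gamma^{n+m}$. (b) If $G$ is a graph with $n$ vertices, then its neighbourhood complex satisfies $\mathrm{b}(\mathcal{N}(G))\leq (\Gamma^2)^n$. (c) If $K$ is any simplicial complex with $n$ vertices and $m$ minimal non-faces, then $\mathrm{b}(K)\leq \Gamma^{n+m}$.
   Context: Fix a field $\mathbf{k}$. For a space $X$, $\mathrm{b}(X)=\sum_i \dim_{\mathbf{k}}\widetilde{H}_i(X;\mathbf{k})$ is the total reduced Betti number (with $\mathrm{b}(\emptyset)=1$ for the empty complex, whose only reduced homology is in degree $-1$). A non-face of a simplicial complex $K$ is a subset of its vertex set that is not a face; a minimal non-face is one all of whose proper subsets are faces. For a finite simple graph $G$, the neighbourhood complex $\mathcal{N}(G)$ is the simplicial complex whose vertices are the non-isolated vertices of $G$ and whose faces are the vertex subsets having a common neighbour in $G$. -}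

module Defs where

open import Level using (Level; _⊔_)
open import Data.Nat as ℕ using (ℕ; zero; suc)
open import Data.Bool using (Bool; true; false; _∧_; _∨_; not; if_then_else_)
open import Data.Fin using (Fin; zero; suc; _<?_)
open import Data.Vec using (Vec; []; _∷_; _[_]≔_)
open import Data.Fin.Subset using (Subset; ∣_∣; inside; outside)
open import Data.List using (List; []; _∷_; _++_; map; filter; length)
open import Data.Product using (Σ; ∃; _×_; _,_)
open import Data.Sum using (_⊎_)
open import Relation.Nullary using (¬_)
open import Relation.Nullary.Decidable using (⌊_⌋)
open import Relation.Binary.PropositionalEquality using (_≡_)
open import Algebra.Bundles using (CommutativeRing)
open import Data.Rational as ℚ using (ℚ)
import Data.Integer as ℤ

record Field (c ℓ : Level) : Set (Level.suc (c ⊔ ℓ)) where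
  field
    commutativeRing : CommutativeRing c ℓ
  open CommutativeRing commutativeRing public
  field
    0≉1     : ¬ (0# ≈ 1#)
    inverse : ∀ x → ¬ (x ≈ 0#) → ∃ λ y → x * y ≈ 1#

anyFin : ∀ {n} → (Fin n → Bool) → Bool
anyFin {zero}  p = false
anyFin {suc n} p = p zero ∨ anyFin (λ i → p (suc i))

allFin : ∀ {n} → (Fin n → Bool) → Bool
allFin {zero}  p = true
allFin {suc n} p = p zero ∧ allFin (λ i → p (suc i))

memb : ∀ {n} → Fin n → Subset n → Bool
memb zero    (b ∷ _) = b
memb (suc i) (_ ∷ s) = memb i s

subsetB : ∀ {n} → Subset n → Subset n → Bool
subsetB s t = allFin (λ i → not (memb i s) ∨ memb i t)

eqB : ∀ {n} → Subset n → Subset n → Bool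
eqB s t = subsetB s t ∧ subsetB t s

allSubsets : ∀ n → List (Subset n)
allSubsets zero    = [] ∷ []
allSubsets (suc n) = map (outside ∷_) (allSubsets n) ++ map (inside ∷_) (allSubsets n)

allList : ∀ {A : Set} → (A → Bool) → List A → Bool
allList p [] = true
allList p (x ∷ xs) = p x ∧ allList p xs

countB : ∀ {n} → (Subset n → Bool) → ℕ
countB {n} p = length (filter (λ s → Data.Bool._≟_ (p s) true) (allSubsets n))
  where import Data.Bool

-- Finite abstract simplicial complexes with ground set Fin n.
-- Faces are given by a Boolean predicate on subsets, closed under
-- taking subsets.  (This includes the void complex.)

record Complex (n : ℕ) : Set where
  field
    face    : Subset n → Bool
    downward : ∀ σ τ → subsetB σ τ ≡ true → face τ ≡ true → face σ ≡ true
open Complex public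

-- K has vertex set exactly Fin n: every singleton is a face
-- (this also forces ∅ to be a face when n ≥ 1; for n = 0 we require ∅ to be a face,
--  i.e. K is the empty complex {∅}, not the void complex)
HasVertexSet : ∀ {n} → Complex n → Set
HasVertexSet {n} K = face K (Data.Vec.replicate n outside) ≡ true
                   × (∀ (v : Fin n) → face K (Data.Vec.replicate n outside [ v ]≔ inside) ≡ true)
  where import Data.Vec

isMaximalFace : ∀ {n} → Complex n → Subset n → Bool
isMaximalFace {n} K σ =
  face K σ ∧ allList (λ τ → not (face K τ ∧ subsetB σ τ) ∨ eqB τ σ) (allSubsets n)

isMinimalNonFace : ∀ {n} → Complex n → Subset n → Bool
isMinimalNonFace {n} K σ =
  not (face K σ) ∧ allList (λ τ → not (subsetB τ σ ∧ not (eqB τ σ)) ∨ face K τ) (allSubsets n)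

numMaximalFaces : ∀ {n} → Complex n → ℕ
numMaximalFaces K = countB (isMaximalFace K)

numMinimalNonFaces : ∀ {n} → Complex n → ℕ
numMinimalNonFaces K = countB (isMinimalNonFace K)

record Graph (n : ℕ) : Set where
  field
    adj   : Fin n → Fin n → Bool
    sym   : ∀ u v → adj u v ≡ adj v u
    irrefl : ∀ v → adj v v ≡ false
open Graph public

-- faces: vertex subsets having a common neighbour.  Its vertices are exactly
-- the non-isolated vertices of G (the other elements of Fin n are not vertices).
nbhdFace : ∀ {n} → Graph n → Subset n → Bool
nbhdFace G σ = anyFin (λ w → allFin (λ v → not (memb v σ) ∨ adj G v w))

neighbourhoodComplex : ∀ {n} → Graph n → Complex n
neighbourhoodComplex {n} G = record { face = nbhdFace G ; downward = down }
  where
  open import Data.Bool.Properties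
  open import Relation.Binary.PropositionalEquality using (refl)
  allFin-mono : ∀ {m} (p q : Fin m → Bool) → (∀ i → p i ≡ true → q i ≡ true) →
                allFin p ≡ true → allFin q ≡ true
  allFin-mono {zero} p q h e = refl
  allFin-mono {suc m} p q h e with p zero in ep | q zero in eq0
  ... | true  | true  = allFin-mono (λ i → p (suc i)) (λ i → q (suc i)) (λ i → h (suc i)) e
  ... | true  | false with () ← Relation.Binary.PropositionalEquality.trans (Relation.Binary.PropositionalEquality.sym eq0) (h zero ep)
  ... | false | _  with () ← e
  anyFin-mono : ∀ {m} (p q : Fin m → Bool) → (∀ i → p i ≡ true → q i ≡ true) →
                anyFin p ≡ true → anyFin q ≡ true
  anyFin-mono {zero} p q h ()
  anyFin-mono {suc m} p q h e with p zero in ep | q zero in eq0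
  ... | true | true = refl
  ... | true | false with () ← Relation.Binary.PropositionalEquality.trans (Relation.Binary.PropositionalEquality.sym eq0) (h zero ep)
  ... | false | true = refl
  ... | false | false = anyFin-mono (λ i → p (suc i)) (λ i → q (suc i)) (λ i → h (suc i)) e
  memb-sub : ∀ {m} (s t : Subset m) → subsetB s t ≡ true → ∀ v → memb v s ≡ true → memb v t ≡ true
  memb-sub (true ∷ s) (true ∷ t) e zero _ = refl
  memb-sub (true ∷ s) (false ∷ t) () zero _
  memb-sub (false ∷ s) t e zero ()
  memb-sub (b ∷ s) (c ∷ t) e (suc v) mv = memb-sub s t (lem b c e) v mv
    where
    lem : ∀ b c → subsetB (b ∷ s) (c ∷ t) ≡ true → subsetB s t ≡ true
    lem false c e = e
    lem true true e = e
    lem true false ()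
  down : ∀ σ τ → subsetB σ τ ≡ true → nbhdFace G τ ≡ true → nbhdFace G σ ≡ true
  down σ τ st = anyFin-mono _ _ λ w → allFin-mono _ _ λ v → step v w
    where
    step : ∀ v w → not (memb v τ) ∨ adj G v w ≡ true → not (memb v σ) ∨ adj G v w ≡ true
    step v w e with memb v σ in ms
    ... | false = refl
    ... | true with memb v τ in mt | memb-sub σ τ st v ms
    ... | true | _ = e
    ... | false | ()

-- Reduced simplicial homology over a field F.
-- A chain is a function Subset n → Carrier; a j-chain is one supported on
-- faces of cardinality j (i.e. dimension j - 1; j = 0 is the degree -1 part,
-- spanned by the empty face, which gives the augmented = reduced complex).
-- The boundary of a chain c is
--   (∂ c)(τ) = Σ_{v ∉ τ} (-1)^{#{u ∈ τ | u < v}} c(τ ∪ {v}),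
-- using the order of Fin n to orient simplices.

module Homology {c ℓ : Level} (F : Field c ℓ) where
  open Field F using (Carrier; _≈_; _+_; _*_; -_; 0#; 1#)

  Chain : ℕ → Set c
  Chain n = Subset n → Carrier

  sumFin : ∀ {m} → (Fin m → Carrier) → Carrier
  sumFin {zero}  f = 0#
  sumFin {suc m} f = f zero + sumFin (λ i → f (suc i))

  countBelow : ∀ {n} → Subset n → Fin n → ℕ
  countBelow {n} τ v = countFin (λ u → memb u τ ∧ ⌊ u <? v ⌋)
    where
    countFin : ∀ {m} → (Fin m → Bool) → ℕ
    countFin {zero} p = 0
    countFin {suc m} p = (if p zero then 1 else 0) ℕ.+ countFin (λ i → p (suc i))

  signed : ℕ → Carrier → Carrier
  signed zero x = x
  signed (suc k) x = - signed k x

  ∂ : ∀ {n} → Chain n → Chain n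
  ∂ x τ = sumFin (λ v → if memb v τ then 0# else signed (countBelow τ v) (x (τ [ v ]≔ inside)))

  IsChain : ∀ {n} → Complex n → ℕ → Chain n → Set ℓ
  IsChain K j x = ∀ σ → ¬ (face K σ ≡ true × ∣ σ ∣ ≡ j) → x σ ≈ 0#

  IsCycle : ∀ {n} → Complex n → ℕ → Chain n → Set ℓ
  IsCycle K j x = IsChain K j x × (∀ τ → ∂ x τ ≈ 0#)

  IsBoundary : ∀ {n} → Complex n → ℕ → Chain n → Set (c ⊔ ℓ)
  IsBoundary K j x = ∃ λ w → IsChain K (suc j) w × (∀ τ → ∂ w τ ≈ x τ)

  lincomb : ∀ {n d} → (Fin d → Carrier) → (Fin d → Chain n) → Chain n
  lincomb a z σ = sumFin (λ l → a l * z l σ)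

  IndependentModBoundaries : ∀ {n d} → Complex n → ℕ → (Fin d → Chain n) → Set (c ⊔ ℓ)
  IndependentModBoundaries K j z = ∀ a → IsBoundary K j (lincomb a z) → ∀ l → a l ≈ 0#

  -- dim_k H̃_{j-1}(K; k) = d
  HasHomologyDim : ∀ {n} → Complex n → ℕ → ℕ → Set (c ⊔ ℓ)
  HasHomologyDim {n} K j d =
    (∃ λ (z : Fin d → Chain n) → (∀ l → IsCycle K j (z l)) × IndependentModBoundaries K j z)
    × (∀ (z : Fin (suc d) → Chain n) → (∀ l → IsCycle K j (z l)) → ¬ IndependentModBoundaries K j z)

  sumUpTo : ℕ → (ℕ → ℕ) → ℕ
  sumUpTo zero    β = β 0
  sumUpTo (suc k) β = sumUpTo k β ℕ.+ β (suc k)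

  -- b(K) = Σ_i dim H̃_i(K; k), summing over i = -1, …, n-1 (all others vanish)
  TotalBetti : ∀ {n} → Complex n → ℕ → Set (c ⊔ ℓ)
  TotalBetti {n} K b = ∃ λ (β : ℕ → ℕ) → (∀ j → HasHomologyDim K j (β j)) × b ≡ sumUpTo n β

-- Γ is the unique real in [1,2] with Γ^-4 + Γ^-5 + Γ^-6 = 1.
-- For r > 0, r^-4 + r^-5 + r^-6 < 1 iff r^6 > r^2 + r + 1, and the set of such
-- r is exactly the open ray (Γ, ∞).  Hence for a real y, y ≤ Γ^N iff
-- y ≤ r^N for every rational r > 0 with r^-4 + r^-5 + r^-6 < 1.

powℚ : ℚ → ℕ → ℚ
powℚ r zero    = ℚ.1ℚ
powℚ r (suc k) = r ℚ.* powℚ r k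

AboveΓ : ℚ → Set
AboveΓ r = ℚ.0ℚ ℚ.< r × powℚ r 2 ℚ.+ r ℚ.+ ℚ.1ℚ ℚ.< powℚ r 6

_≤Γ^_ : ℕ → ℕ → Set
b ≤Γ^ N = ∀ r → AboveΓ r → ((ℤ.+ b) ℚ./ 1) ℚ.≤ powℚ r N

_≤Γ²^_ : ℕ → ℕ → Set
b ≤Γ²^ N = ∀ r → AboveΓ r → ((ℤ.+ b) ℚ./ 1) ℚ.≤ powℚ (powℚ r 2) N

{-# OPTIONS --safe #-}
module Submission where

-- The rows and columns of an incidence relation between n vertices and m blocks form a bipartite
-- graph.  Each of the three complexes (or its Alexander dual, in the case of minimal non-faces) has
-- the homology of the independence complex of that graph up to a shift of degree, so it suffices to
-- bound the Betti numbers of the independence complex of a triangle-free graph on N vertices by Γ^N.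
-- Choose a vertex v of minimum degree d.  The independent sets avoiding all neighbours w₁, …, w_d of v
-- cancel in pairs, by adding or removing v.  In the others let wᵢ be the first neighbour present; then
-- w₁, …, wᵢ and the at least d neighbours of wᵢ are decided, and these are distinct as there are no
-- triangles, leaving at most N − d − i free vertices.  So the induction needs
-- Γ^−(d+1) + … + Γ^−2d ≤ 1, that is 1 + Γ + … + Γ^(d−1) ≤ Γ^2d, which for d = 3 is the equation
-- defining Γ and holds for all other d as well.

open import Defs hiding (sym)
open import Level using (Level; _⊔_)
open import Data.Nat as ℕ using (ℕ; zero; suc; _+_; _≤_; _<_; z≤n; s≤s; s≤s⁻¹)
import Data.Nat.Properties as ℕP
open import Data.Nat.Coprimality using (1-coprimeTo) renaming (sym to coprime-sym)
import Data.Integer as ℤ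
import Data.Integer.Properties as ℤP
open import Data.Rational as ℚ using (ℚ; 0ℚ; 1ℚ; mkℚ)
import Data.Rational.Properties as ℚP
import Data.Rational.Unnormalised as ℚᵘ
open import Data.Rational.Solver using (module +-*-Solver)
open import Data.Unit using (⊤; tt)
open import Data.Empty using (⊥; ⊥-elim)
open import Data.Bool using (Bool; true; false; not; _∧_; _∨_; if_then_else_)
open import Data.Bool.Properties using (∧-zeroʳ; ∧-identityʳ; ¬-not; not-involutive) renaming (_≟_ to _≟ᵇ_)
open import Data.Product using (Σ; ∃; _×_; _,_; proj₁; proj₂)
open import Data.Sum using (_⊎_; inj₁; inj₂; [_,_]′)
open import Data.Fin using (Fin; zero; suc; _≟_; _<?_; toℕ; fromℕ<; punchIn; splitAt; join; _↑ˡ_; _↑ʳ_)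
open import Data.Fin.Properties using (all?; any?; toℕ-fromℕ<; toℕ-injective; toℕ<n; join-splitAt; splitAt-↑ˡ; splitAt-↑ʳ; splitAt⁻¹-↑ˡ; splitAt⁻¹-↑ʳ)
open import Data.Fin.Subset using (Subset; ∣_∣; inside; ∁)
open import Data.Fin.Subset.Properties using (∣p∣≤n)
open import Data.Vec using ([]; _∷_; _++_; _[_]≔_; replicate; tabulate; take; drop)
open import Data.Vec.Properties using (≡-dec; take++drop≡id)
open import Data.Vec.Functional using (insertAt)
open import Data.Vec.Functional.Properties using (insertAt-lookup; insertAt-punchIn)
open import Data.List using (List; []; _∷_; filter; lookup)
open import Data.List.Membership.Propositional using (_∈_)
open import Data.List.Membership.Propositional.Properties using (∈-lookup; ∈-filter⁺; ∈-filter⁻; ∈-map⁺; ∈-++⁺ˡ; ∈-++⁺ʳ)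
open import Data.List.Relation.Unary.Any using (here; index)
open import Data.List.Relation.Unary.Any.Properties using (lookup-index)
open import Function using (_∘_)
open import Relation.Nullary using (¬_; Dec; yes; no; does; contradiction)
open import Relation.Nullary.Decidable using (⌊_⌋; isYes≗does; ¬?; _×-dec_; _⊎-dec_; _→-dec_; dec-true; dec-false; decidable-stable)
open import Relation.Unary using (Decidable; _⊆_)
open import Relation.Binary.PropositionalEquality as ≡ using (_≡_; _≢_; cong; cong₂; subst; subst₂)
import Algebra.Properties.CommutativeSemigroup
import Algebra.Properties.Ring
import Relation.Binary.Reasoning.Setoid

-- Field elements cannot be compared with zero, so no ranks can be computed and no bases selected.
-- Every homological step is therefore an explicit linear map that produces bounding chains, and the
-- one case distinction on field elements is confined to `wide-kernel`, whose conclusion is a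
-- negation. Chains are not graded: a bound concerns all degrees at once, so the degree shifts
-- between the complexes never have to be written down. Degrees return only when the bases of the
-- single homology groups are merged in `Total`. Alexander duality is not established as a theorem.
-- The matching tree uses just the four operations of `Rules`, and each of them survives when a
-- filtration by lower sets is turned upside down by complementation; so the same tree runs in the
-- dual complex. The real number Γ is replaced throughout by a rational r above it.

module ℕ+ = Algebra.Properties.CommutativeSemigroup ℕP.+-commutativeSemigroup
open +-*-Solver using (solve; _:=_; _:+_; _:*_; _:-_; con)

-- Membership, insertion and complements of subsets

_⊑_ : ∀ {n} → Subset n → Subset n → Set
σ ⊑ τ = ∀ i → memb i σ ≡ true → memb i τ ≡ true

Lower : ∀ {n} → (Subset n → Set) → Set
Lower P = ∀ {σ τ} → σ ⊑ τ → P τ → P σ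

memb-≔ : ∀ {n} (σ : Subset n) i b → memb i (σ [ i ]≔ b) ≡ b
memb-≔ (x ∷ σ) zero    b = ≡.refl
memb-≔ (x ∷ σ) (suc i) b = memb-≔ σ i b

memb-≔-≢ : ∀ {n} (σ : Subset n) {i j} b → i ≢ j → memb i (σ [ j ]≔ b) ≡ memb i σ
memb-≔-≢ (x ∷ σ) {zero}  {zero}  b i≢j = ⊥-elim (i≢j ≡.refl)
memb-≔-≢ (x ∷ σ) {zero}  {suc j} b i≢j = ≡.refl
memb-≔-≢ (x ∷ σ) {suc i} {zero}  b i≢j = ≡.refl
memb-≔-≢ (x ∷ σ) {suc i} {suc j} b i≢j = memb-≔-≢ σ b (i≢j ∘ cong suc)

≔-≔-memb : ∀ {n} (σ : Subset n) i b → (σ [ i ]≔ b) [ i ]≔ memb i σ ≡ σ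
≔-≔-memb (x ∷ σ) zero    b = ≡.refl
≔-≔-memb (x ∷ σ) (suc i) b = cong (x ∷_) (≔-≔-memb σ i b)

⊑-insert : ∀ {n} (σ : Subset n) i → σ ⊑ (σ [ i ]≔ true)
⊑-insert (x ∷ σ) zero    zero    e = ≡.refl
⊑-insert (x ∷ σ) zero    (suc j) e = e
⊑-insert (x ∷ σ) (suc i) zero    e = e
⊑-insert (x ∷ σ) (suc i) (suc j) e = ⊑-insert σ i j e

memb-∁ : ∀ {n} i (σ : Subset n) → memb i (∁ σ) ≡ not (memb i σ)
memb-∁ zero    (x ∷ σ) = ≡.refl
memb-∁ (suc i) (x ∷ σ) = memb-∁ i σ

∁-≔ : ∀ {n} (σ : Subset n) i b → ∁ (σ [ i ]≔ b) ≡ ∁ σ [ i ]≔ not b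
∁-≔ (x ∷ σ) zero    b = ≡.refl
∁-≔ (x ∷ σ) (suc i) b = cong (not x ∷_) (∁-≔ σ i b)

∁-involutive : ∀ {n} (σ : Subset n) → ∁ (∁ σ) ≡ σ
∁-involutive []          = ≡.refl
∁-involutive (true ∷ σ)  = cong (true ∷_) (∁-involutive σ)
∁-involutive (false ∷ σ) = cong (false ∷_) (∁-involutive σ)

∁-⊑ : ∀ {n} {σ τ : Subset n} → σ ⊑ τ → ∁ τ ⊑ ∁ σ
∁-⊑ {σ = σ} {τ} s i e with memb i σ in eq
... | false = ≡.trans (memb-∁ i σ) (cong not eq)
... | true  with () ← ≡.trans (≡.sym e) (≡.trans (memb-∁ i τ) (cong not (s i eq)))

-- Adding and removing `v` pairs off the members of such a family: an element matching in the sense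
-- of discrete Morse theory.
ToggleClosed : ∀ {n} → Fin n → (Subset n → Set) → Set
ToggleClosed v G = ∀ σ b → G σ → G (σ [ v ]≔ b)

Diff : ∀ {n} → (P′ P : Subset n → Set) → Subset n → Set
Diff P′ P σ = P′ σ × ¬ P σ

-- Chains and linear maps

module Linear {c ℓ : Level} (F : Field c ℓ) where
  open Homology F
  open Field F
    using (Carrier; _≈_; 0#; 1#; refl; sym; trans; setoid; ring; +-commutativeSemigroup; +-cong;
           +-congˡ; +-congʳ; -‿cong; +-assoc; +-comm; +-identityˡ; +-identityʳ; -‿inverseˡ; -‿inverseʳ;
           *-identityˡ; distribˡ; zeroˡ; zeroʳ)
    renaming (_+_ to _⊕_; _*_ to _⊗_; -_ to ⊖_)
  open Algebra.Properties.Ring ring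
    using (-0#≈0#; -‿distribʳ-*; -‿distribˡ-*; -‿+-comm; -‿involutive)
  open Algebra.Properties.CommutativeSemigroup +-commutativeSemigroup using (interchange) public
  open Relation.Binary.Reasoning.Setoid setoid

  private
    variable
      A B C : Set
      n m k : ℕ

  ⊕-zero : ∀ {x y} → x ≈ 0# → y ≈ 0# → x ⊕ y ≈ 0#
  ⊕-zero p q = trans (+-cong p q) (+-identityˡ 0#)

  ⊖-zero : ∀ {x} → x ≈ 0# → ⊖ x ≈ 0#
  ⊖-zero p = trans (-‿cong p) -0#≈0#

  infixl 6 _∸_
  _∸_ : Carrier → Carrier → Carrier
  x ∸ y = x ⊕ ⊖ y

  ∸-cong : ∀ {x x′ y y′} → x ≈ x′ → y ≈ y′ → x ∸ y ≈ x′ ∸ y′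
  ∸-cong p q = +-cong p (-‿cong q)

  ∸-zero : ∀ {x y} → x ≈ 0# → y ≈ 0# → x ∸ y ≈ 0#
  ∸-zero p q = ⊕-zero p (⊖-zero q)

  ∸-zeroʳ : ∀ {x y} → y ≈ 0# → x ∸ y ≈ x
  ∸-zeroʳ {x} q = trans (+-congˡ (⊖-zero q)) (+-identityʳ x)

  x≈y⇒x∸y≈0 : ∀ {x y} → x ≈ y → x ∸ y ≈ 0#
  x≈y⇒x∸y≈0 {x} {y} p = trans (+-congʳ p) (-‿inverseʳ y)

  x⊕y≈z⇒z∸y≈x : ∀ {x y z} → x ⊕ y ≈ z → z ∸ y ≈ x
  x⊕y≈z⇒z∸y≈x {x} {y} {z} p = begin
    z ⊕ ⊖ y         ≈⟨ +-congʳ (sym p) ⟩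
    (x ⊕ y) ⊕ ⊖ y   ≈⟨ +-assoc x y (⊖ y) ⟩
    x ⊕ (y ⊕ ⊖ y)   ≈⟨ +-congˡ (-‿inverseʳ y) ⟩
    x ⊕ 0#          ≈⟨ +-identityʳ x ⟩
    x               ∎

  x∸y⊕y≈x : ∀ x y → (x ∸ y) ⊕ y ≈ x
  x∸y⊕y≈x x y = begin
    (x ⊕ ⊖ y) ⊕ y ≈⟨ +-assoc x (⊖ y) y ⟩
    x ⊕ (⊖ y ⊕ y) ≈⟨ +-congˡ (-‿inverseˡ y) ⟩
    x ⊕ 0#        ≈⟨ +-identityʳ x ⟩
    x             ∎

  -- Vectors are functions into a setoid, so respect for pointwise equality has to be a field of its
  -- own.
  record Lin (A B : Set) : Set (c ⊔ ℓ) where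
    field
      ap      : (A → Carrier) → B → Carrier
      ap-cong : ∀ {x y} → (∀ a → x a ≈ y a) → ∀ b → ap x b ≈ ap y b
      ap-⊕    : ∀ x y b → ap (λ a → x a ⊕ y a) b ≈ ap x b ⊕ ap y b
      ap-⊗    : ∀ s x b → ap (λ a → s ⊗ x a) b ≈ s ⊗ ap x b

    ap-0 : ∀ {x} → (∀ a → x a ≈ 0#) → ∀ b → ap x b ≈ 0#
    ap-0 {x} x≈0 b = begin
      ap x b                 ≈⟨ ap-cong (λ a → trans (x≈0 a) (sym (zeroˡ (x a)))) b ⟩
      ap (λ a → 0# ⊗ x a) b  ≈⟨ ap-⊗ 0# x b ⟩
      0# ⊗ ap x b            ≈⟨ zeroˡ _ ⟩
      0#                     ∎

    ap-⊖ : ∀ x b → ap (λ a → ⊖ x a) b ≈ ⊖ ap x b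
    ap-⊖ x b = begin
      ap (λ a → ⊖ x a) b        ≈⟨ ap-cong (λ a → sym (trans (sym (-‿distribˡ-* 1# (x a))) (-‿cong (*-identityˡ (x a))))) b ⟩
      ap (λ a → ⊖ 1# ⊗ x a) b   ≈⟨ ap-⊗ (⊖ 1#) x b ⟩
      ⊖ 1# ⊗ ap x b             ≈⟨ trans (sym (-‿distribˡ-* 1# _)) (-‿cong (*-identityˡ _)) ⟩
      ⊖ ap x b                  ∎

    ap-∸ : ∀ x y b → ap (λ a → x a ∸ y a) b ≈ ap x b ∸ ap y b
    ap-∸ x y b = trans (ap-⊕ x (λ a → ⊖ y a) b) (+-congˡ (ap-⊖ y b))

    ap-sum : ∀ {d} (a : Fin d → Carrier) (z : Fin d → A → Carrier) b →
             ap (λ i → sumFin (λ l → a l ⊗ z l i)) b ≈ sumFin (λ l → a l ⊗ ap (z l) b)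
    ap-sum {zero}  a z b = ap-0 (λ _ → refl) b
    ap-sum {suc d} a z b = begin
      ap (λ i → a zero ⊗ z zero i ⊕ sumFin (λ l → a (suc l) ⊗ z (suc l) i)) b  ≈⟨ ap-⊕ _ _ b ⟩
      ap (λ i → a zero ⊗ z zero i) b ⊕ ap (λ i → sumFin (λ l → a (suc l) ⊗ z (suc l) i)) b
        ≈⟨ +-cong (ap-⊗ (a zero) (z zero) b) (ap-sum (a ∘ suc) (z ∘ suc) b) ⟩
      a zero ⊗ ap (z zero) b ⊕ sumFin (λ l → a (suc l) ⊗ ap (z (suc l)) b) ∎

  open Lin public

  infixr 9 _∘ₗ_
  infixl 6 _⊕ₗ_ _∸ₗ_

  idₗ : Lin A A
  idₗ = record { ap = λ x → x ; ap-cong = λ e → e ; ap-⊕ = λ _ _ _ → refl ; ap-⊗ = λ _ _ _ → refl }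

  zeroₗ : Lin A B
  zeroₗ = record
    { ap = λ _ _ → 0# ; ap-cong = λ _ _ → refl
    ; ap-⊕ = λ _ _ _ → sym (+-identityˡ 0#) ; ap-⊗ = λ s _ _ → sym (zeroʳ s) }

  _∘ₗ_ : Lin B C → Lin A B → Lin A C
  g ∘ₗ f = record
    { ap      = λ x → ap g (ap f x)
    ; ap-cong = λ e → ap-cong g (ap-cong f e)
    ; ap-⊕    = λ x y b → trans (ap-cong g (ap-⊕ f x y) b) (ap-⊕ g _ _ b)
    ; ap-⊗    = λ s x b → trans (ap-cong g (ap-⊗ f s x) b) (ap-⊗ g s _ b) }

  _⊕ₗ_ : Lin A B → Lin A B → Lin A B
  f ⊕ₗ g = record
    { ap      = λ x b → ap f x b ⊕ ap g x b
    ; ap-cong = λ e b → +-cong (ap-cong f e b) (ap-cong g e b)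
    ; ap-⊕    = λ x y b → trans (+-cong (ap-⊕ f x y b) (ap-⊕ g x y b)) (interchange _ _ _ _)
    ; ap-⊗    = λ s x b → trans (+-cong (ap-⊗ f s x b) (ap-⊗ g s x b)) (sym (distribˡ s _ _)) }

  ⊖ₗ_ : Lin A B → Lin A B
  ⊖ₗ f = record
    { ap      = λ x b → ⊖ ap f x b
    ; ap-cong = λ e b → -‿cong (ap-cong f e b)
    ; ap-⊕    = λ x y b → trans (-‿cong (ap-⊕ f x y b)) (sym (-‿+-comm _ _))
    ; ap-⊗    = λ s x b → trans (-‿cong (ap-⊗ f s x b)) (-‿distribʳ-* s _) }

  _∸ₗ_ : Lin A B → Lin A B → Lin A B
  f ∸ₗ g = f ⊕ₗ (⊖ₗ g)

  reindex : (B → A) → Lin A B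
  reindex f = record
    { ap = λ x b → x (f b) ; ap-cong = λ e b → e (f b) ; ap-⊕ = λ _ _ _ → refl ; ap-⊗ = λ _ _ _ → refl }

  mask : (A → Bool) → Lin A A
  mask g = record
    { ap      = λ x a → if g a then x a else 0#
    ; ap-cong = λ e a → congᵐ (g a) (e a)
    ; ap-⊕    = λ x y a → addᵐ (g a) (x a) (y a)
    ; ap-⊗    = λ s x a → scaleᵐ (g a) s (x a) }
    where
    congᵐ : ∀ b {x y} → x ≈ y → (if b then x else 0#) ≈ (if b then y else 0#)
    congᵐ true  e = e
    congᵐ false e = refl
    addᵐ : ∀ b x y → (if b then x ⊕ y else 0#) ≈ (if b then x else 0#) ⊕ (if b then y else 0#)
    addᵐ true  x y = refl
    addᵐ false x y = sym (+-identityˡ 0#)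
    scaleᵐ : ∀ b s x → (if b then s ⊗ x else 0#) ≈ s ⊗ (if b then x else 0#)
    scaleᵐ true  s x = refl
    scaleᵐ false s x = sym (zeroʳ s)

  fork : Lin A (Subset n) → Lin A (Subset n) → Lin A (Subset (suc n))
  fork f g = record
    { ap      = λ { x (false ∷ σ) → ap f x σ           ; x (true ∷ σ) → ap g x σ }
    ; ap-cong = λ { e (false ∷ σ) → ap-cong f e σ      ; e (true ∷ σ) → ap-cong g e σ }
    ; ap-⊕    = λ { x y (false ∷ σ) → ap-⊕ f x y σ     ; x y (true ∷ σ) → ap-⊕ g x y σ }
    ; ap-⊗    = λ { s x (false ∷ σ) → ap-⊗ f s x σ     ; s x (true ∷ σ) → ap-⊗ g s x σ } }

  consₗ : B → Lin A B → Lin A (Fin k) → Lin A (Fin (suc k))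
  consₗ p f φ = record
    { ap      = λ { x zero → ap f x p           ; x (suc i) → ap φ x i }
    ; ap-cong = λ { e zero → ap-cong f e p      ; e (suc i) → ap-cong φ e i }
    ; ap-⊕    = λ { x y zero → ap-⊕ f x y p     ; x y (suc i) → ap-⊕ φ x y i }
    ; ap-⊗    = λ { s x zero → ap-⊗ f s x p     ; s x (suc i) → ap-⊗ φ s x i } }

  -- The boundary operator and exterior multiplication by a vertex

  slice : Bool → Lin (Subset (suc n)) (Subset n)
  slice b = reindex (b ∷_)

  -- With e the first vertex, a chain is x₀ + e ∧ x₁, and ∂(x₀ + e ∧ x₁) = ∂x₀ + x₁ - e ∧ ∂x₁. In
  -- this form no signs have to be counted; `∂≈∂ₗ` links it to the given definition.
  ∂ₗ : ∀ n → Lin (Subset n) (Subset n)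
  ∂ₗ zero    = zeroₗ
  ∂ₗ (suc n) = fork (slice true ⊕ₗ ∂ₗ n ∘ₗ slice false) (⊖ₗ (∂ₗ n ∘ₗ slice true))

  wedge : Fin n → Lin (Subset n) (Subset n)
  wedge zero    = fork zeroₗ (slice false)
  wedge (suc v) = fork (wedge v ∘ₗ slice false) (⊖ₗ (wedge v ∘ₗ slice true))

  ∂∂≈0 : ∀ n (x : Chain n) σ → ap (∂ₗ n) (ap (∂ₗ n) x) σ ≈ 0#
  ∂∂≈0 zero    x σ           = refl
  ∂∂≈0 (suc n) x (false ∷ σ) = begin
    ⊖ ap (∂ₗ n) x₁ σ ⊕ ap (∂ₗ n) (λ τ → x₁ τ ⊕ ap (∂ₗ n) x₀ τ) σ
      ≈⟨ +-congˡ (trans (ap-⊕ (∂ₗ n) _ _ σ) (trans (+-congˡ (∂∂≈0 n x₀ σ)) (+-identityʳ _))) ⟩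
    ⊖ ap (∂ₗ n) x₁ σ ⊕ ap (∂ₗ n) x₁ σ  ≈⟨ -‿inverseˡ _ ⟩
    0# ∎
    where x₀ = λ τ → x (false ∷ τ)
          x₁ = λ τ → x (true ∷ τ)
  ∂∂≈0 (suc n) x (true ∷ σ)  =
    ⊖-zero (trans (ap-⊖ (∂ₗ n) _ σ) (⊖-zero (∂∂≈0 n _ σ)))

  -- The boundary is an antiderivation that takes every vertex to 1, so ∂(v ∧ x) = x - v ∧ ∂x.
  -- Coning at `v` is thus a null homotopy of the full simplex.
  ∂-wedge : ∀ (v : Fin n) x σ →
            ap (∂ₗ n) (ap (wedge v) x) σ ⊕ ap (wedge v) (ap (∂ₗ n) x) σ ≈ x σ
  ∂-wedge {suc n} zero x (false ∷ σ) = begin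
    (x (false ∷ σ) ⊕ ap (∂ₗ n) (λ _ → 0#) σ) ⊕ 0#  ≈⟨ +-identityʳ _ ⟩
    x (false ∷ σ) ⊕ ap (∂ₗ n) (λ _ → 0#) σ  ≈⟨ +-congˡ (ap-0 (∂ₗ n) (λ _ → refl) σ) ⟩
    x (false ∷ σ) ⊕ 0#  ≈⟨ +-identityʳ _ ⟩
    x (false ∷ σ) ∎
  ∂-wedge {suc n} zero x (true ∷ σ) = begin
    ⊖ d ⊕ (x (true ∷ σ) ⊕ d)  ≈⟨ +-comm _ _ ⟩
    (x (true ∷ σ) ⊕ d) ⊕ ⊖ d  ≈⟨ x⊕y≈z⇒z∸y≈x refl ⟩
    x (true ∷ σ) ∎
    where d = ap (∂ₗ n) (λ τ → x (false ∷ τ)) σ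
  ∂-wedge {suc n} (suc v) x (false ∷ σ) = begin
    (⊖ e₁ ⊕ ap (∂ₗ n) (ap (wedge v) x₀) σ) ⊕ ap (wedge v) (λ τ → x₁ τ ⊕ ap (∂ₗ n) x₀ τ) σ
      ≈⟨ +-congˡ (ap-⊕ (wedge v) _ _ σ) ⟩
    (⊖ e₁ ⊕ ap (∂ₗ n) (ap (wedge v) x₀) σ) ⊕ (e₁ ⊕ ap (wedge v) (ap (∂ₗ n) x₀) σ)
      ≈⟨ interchange _ _ _ _ ⟩
    (⊖ e₁ ⊕ e₁) ⊕ (ap (∂ₗ n) (ap (wedge v) x₀) σ ⊕ ap (wedge v) (ap (∂ₗ n) x₀) σ)
      ≈⟨ +-cong (-‿inverseˡ e₁) (∂-wedge v x₀ σ) ⟩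
    0# ⊕ x₀ σ  ≈⟨ +-identityˡ _ ⟩
    x₀ σ ∎
    where x₀ = λ τ → x (false ∷ τ)
          x₁ = λ τ → x (true ∷ τ)
          e₁ = ap (wedge v) x₁ σ
  ∂-wedge {suc n} (suc v) x (true ∷ σ) = begin
    ⊖ ap (∂ₗ n) (λ τ → ⊖ ap (wedge v) x₁ τ) σ ⊕ ⊖ ap (wedge v) (λ τ → ⊖ ap (∂ₗ n) x₁ τ) σ
      ≈⟨ +-cong (-‿cong (ap-⊖ (∂ₗ n) _ σ)) (-‿cong (ap-⊖ (wedge v) _ σ)) ⟩
    ⊖ ⊖ ap (∂ₗ n) (ap (wedge v) x₁) σ ⊕ ⊖ ⊖ ap (wedge v) (ap (∂ₗ n) x₁) σ
      ≈⟨ +-cong (-‿involutive _) (-‿involutive _) ⟩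
    ap (∂ₗ n) (ap (wedge v) x₁) σ ⊕ ap (wedge v) (ap (∂ₗ n) x₁) σ ≈⟨ ∂-wedge v x₁ σ ⟩
    x₁ σ ∎
    where x₁ = λ τ → x (true ∷ τ)

  ∂-local : ∀ n (x : Chain n) σ → (∀ v → memb v σ ≡ false → x (σ [ v ]≔ true) ≈ 0#) → ap (∂ₗ n) x σ ≈ 0#
  ∂-local zero    x σ           h = refl
  ∂-local (suc n) x (false ∷ σ) h = ⊕-zero (h zero ≡.refl) (∂-local n _ σ (h ∘ suc))
  ∂-local (suc n) x (true ∷ σ)  h = ⊖-zero (∂-local n _ σ (h ∘ suc))

  wedge-local : ∀ (v : Fin n) x σ → (memb v σ ≡ true → x (σ [ v ]≔ false) ≈ 0#) → ap (wedge v) x σ ≈ 0#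
  wedge-local zero    x (false ∷ σ) h = refl
  wedge-local zero    x (true ∷ σ)  h = h ≡.refl
  wedge-local (suc v) x (false ∷ σ) h = wedge-local v _ σ h
  wedge-local (suc v) x (true ∷ σ)  h = ⊖-zero (wedge-local v _ σ h)

  -- The boundary is homogeneous. The predicate `q` is arbitrary because the slice of the sets
  -- containing the first vertex replaces it by `q ∘ suc`.
  ∂-degree : ∀ n (q : ℕ → Bool) (x : Chain n) σ →
             ap (∂ₗ n) (ap (mask (q ∘ ∣_∣)) x) σ ≈ (if q (suc ∣ σ ∣) then ap (∂ₗ n) x σ else 0#)
  ∂-degree zero q x [] with q 1
  ... | true  = refl
  ... | false = refl
  ∂-degree (suc n) q x (false ∷ σ) with ∂-degree n q (λ τ → x (false ∷ τ)) σ
  ... | ih with q (suc ∣ σ ∣)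
  ... | true  = +-congˡ ih
  ... | false = ⊕-zero refl ih
  ∂-degree (suc n) q x (true ∷ σ) with ∂-degree n (q ∘ suc) (λ τ → x (true ∷ τ)) σ
  ... | ih with q (suc (suc ∣ σ ∣))
  ... | true  = -‿cong ih
  ... | false = ⊖-zero ih

-- Bounds on homology

countFin : ∀ {m} → (Fin m → Bool) → ℕ
countFin {zero}  p = 0
countFin {suc m} p = (if p zero then 1 else 0) + countFin (p ∘ suc)

countFin-cong : ∀ {m} {p q : Fin m → Bool} → (∀ i → p i ≡ q i) → countFin p ≡ countFin q
countFin-cong {zero}  e = ≡.refl
countFin-cong {suc m} e = cong₂ (λ b k → (if b then 1 else 0) + k) (e zero) (countFin-cong (e ∘ suc))

countFin-false : ∀ m → countFin {m} (λ _ → false) ≡ 0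
countFin-false zero    = ≡.refl
countFin-false (suc m) = countFin-false m

module Bounds {c ℓ : Level} (F : Field c ℓ) where
  open Homology F
  open Linear F
  open Field F
    using (Carrier; _≈_; 0#; 1#; 0≉1; inverse; refl; sym; trans; setoid; reflexive; ring; +-cong;
           +-congˡ; +-congʳ; *-congˡ; *-congʳ; -‿cong; +-assoc; +-comm; +-identityˡ; +-identityʳ;
           -‿inverseˡ; *-assoc; *-comm; *-identityˡ; distribˡ; zeroʳ)
    renaming (_+_ to _⊕_; _*_ to _⊗_; -_ to ⊖_)
  open Algebra.Properties.Ring ring
    using (-0#≈0#; -‿distribˡ-*; -‿+-comm)
  open Relation.Binary.Reasoning.Setoid setoid

  private
    variable
      A B C : Set
      n m k : ℕ

  Supp : (Subset n → Set) → Chain n → Set ℓ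
  Supp P z = ∀ σ → ¬ P σ → z σ ≈ 0#

  Supp-⊆ : {P Q : Subset n → Set} {z : Chain n} → P ⊆ Q → Supp P z → Supp Q z
  Supp-⊆ P⊆Q s σ ¬Q = s σ (¬Q ∘ P⊆Q)

  Supp-∂ : {P : Subset n → Set} {z : Chain n} → Lower P → Supp P z → Supp P (ap (∂ₗ n) z)
  Supp-∂ low s σ ¬P = ∂-local _ _ σ λ v _ → s _ (¬P ∘ low (⊑-insert σ v))

  Supp-wedge : ∀ {v} {G : Subset n → Set} {x : Chain n} →
               ToggleClosed v G → Supp G x → Supp G (ap (wedge v) x)
  Supp-wedge {v = v} {G} tc s σ ¬G = wedge-local v _ σ λ e → s _ λ g →
    ¬G (subst G (≡.trans (cong ((σ [ v ]≔ false) [ v ]≔_) (≡.sym e)) (≔-≔-memb σ v false)) (tc _ true g))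

  keep : {P : A → Set} → Decidable P → Lin A A
  keep P? = mask (does ∘ P?)

  module _ {P : A → Set} (P? : Decidable P) where

    keep-in : ∀ x {a} → P a → ap (keep P?) x a ≈ x a
    keep-in x {a} p rewrite dec-true (P? a) p = refl

    keep-out : ∀ x {a} → ¬ P a → ap (keep P?) x a ≈ 0#
    keep-out x {a} ¬p rewrite dec-false (P? a) ¬p = refl

    keep-split : ∀ x a → ap (keep P?) x a ⊕ ap (keep (¬? ∘ P?)) x a ≈ x a
    keep-split x a with P? a
    ... | yes _ = +-identityʳ _
    ... | no _  = +-identityˡ _

  -- A k-dimensional bound on the homology of L: a cycle on which the k linear functionals φ vanish
  -- bounds, and h is a linear choice of bounding chain.  As everything is linear, bounds compose
  -- although equality in the field need not be decidable.
  Bound : (Subset n → Set) → ℕ → Set (c ⊔ ℓ)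
  Bound {n} L k =
    Σ (Lin (Subset n) (Fin k)) λ φ → Σ (Lin (Subset n) (Subset n)) λ h →
    ∀ z → Supp L z → (∀ σ → ap (∂ₗ n) z σ ≈ 0#) → (∀ i → ap φ z i ≈ 0#) →
    Supp L (ap h z) × (∀ σ → ap (∂ₗ n) (ap h z) σ ≈ z σ)

  -- The sets of `P′` outside `P` cancel in pairs at `v`, so the relative complex is acyclic and the
  -- two homologies agree. The map `clear` subtracts from a chain the boundary of the cone at `v`
  -- over its part outside `P`, which pushes it into `P`.
  module Toggle {P P′ : Subset n → Set} (P? : Decidable P) (P′? : Decidable P′)
                (lowP : Lower P) (lowP′ : Lower P′) (P⊆P′ : P ⊆ P′)
                (v : Fin n) (tc : ToggleClosed v (Diff P′ P)) where

    part : Lin (Subset n) (Subset n)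
    part = wedge v ∘ₗ keep (¬? ∘ P?)

    clear : Lin (Subset n) (Subset n)
    clear = idₗ ∸ₗ ∂ₗ n ∘ₗ part

    Supp-keep : ∀ {z} → Supp P′ z → Supp (Diff P′ P) (ap (keep (¬? ∘ P?)) z)
    Supp-keep s σ ¬d with P? σ
    ... | yes p = refl
    ... | no ¬p = s σ λ p′ → ¬d (p′ , ¬p)

    Supp-part : ∀ {z} → Supp P′ z → Supp P′ (ap part z)
    Supp-part s = Supp-⊆ proj₁ (Supp-wedge tc (Supp-keep s))

    -- Let x be the part of z outside `P`. As `P` is closed under boundaries, ∂x agrees with ∂z on
    -- the difference and vanishes there, so `∂-wedge` leaves ∂(v ∧ x) = x. The boundary of z is
    -- required to vanish on the difference only, since `down` clears a bounding chain, which is no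
    -- cycle.
    Supp-clear : ∀ z → Supp P′ z → (∀ σ → Diff P′ P σ → ap (∂ₗ n) z σ ≈ 0#) → Supp P (ap clear z)
    Supp-clear z s ∂z σ ¬p with P′? σ
    ... | no ¬p′ = ∸-zero (s σ ¬p′) (Supp-∂ lowP′ (Supp-part s) σ ¬p′)
    ... | yes p′ = x≈y⇒x∸y≈0 (begin
      z σ  ≈⟨ sym (keep-in (¬? ∘ P?) z ¬p) ⟩
      x σ  ≈⟨ sym (∂-wedge v x σ) ⟩
      ap (∂ₗ n) (ap part z) σ ⊕ ap (wedge v) (ap (∂ₗ n) x) σ
        ≈⟨ +-congˡ (wedge-local v _ σ λ _ → ∂x _ (tc σ false (p′ , ¬p))) ⟩
      ap (∂ₗ n) (ap part z) σ ⊕ 0#  ≈⟨ +-identityʳ _ ⟩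
      ap (∂ₗ n) (ap part z) σ ∎)
      where
      x = ap (keep (¬? ∘ P?)) z
      ∂x : ∀ τ → Diff P′ P τ → ap (∂ₗ n) x τ ≈ 0#
      ∂x τ d = begin
        ap (∂ₗ n) x τ  ≈⟨ sym (+-identityˡ _) ⟩
        0# ⊕ ap (∂ₗ n) x τ  ≈⟨ +-congʳ (sym (Supp-∂ lowP (λ _ → keep-out P? z) τ (proj₂ d))) ⟩
        ap (∂ₗ n) (ap (keep P?) z) τ ⊕ ap (∂ₗ n) x τ ≈⟨ sym (ap-⊕ (∂ₗ n) _ _ τ) ⟩
        ap (∂ₗ n) (λ ρ → ap (keep P?) z ρ ⊕ x ρ) τ  ≈⟨ ap-cong (∂ₗ n) (keep-split P? z) τ ⟩
        ap (∂ₗ n) z τ  ≈⟨ ∂z τ d ⟩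
        0# ∎

    ∂-clear : ∀ z σ → ap (∂ₗ n) (ap clear z) σ ≈ ap (∂ₗ n) z σ
    ∂-clear z σ = trans (ap-∸ (∂ₗ n) _ _ σ) (∸-zeroʳ (∂∂≈0 n _ σ))

    up : Bound P k → Bound P′ k
    up (φ , h , bd) = φ ∘ₗ clear , part ⊕ₗ h ∘ₗ clear , λ z s ∂z φz →
      let (s′ , ∂h) = bd (ap clear z) (Supp-clear z s λ σ _ → ∂z σ)
                         (λ σ → trans (∂-clear z σ) (∂z σ)) φz
      in (λ σ ¬p′ → ⊕-zero (Supp-part s σ ¬p′) (s′ σ (¬p′ ∘ P⊆P′)))
       , λ σ → begin
         ap (∂ₗ n) (λ τ → ap part z τ ⊕ ap h (ap clear z) τ) σ  ≈⟨ ap-⊕ (∂ₗ n) _ _ σ ⟩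
         ap (∂ₗ n) (ap part z) σ ⊕ ap (∂ₗ n) (ap h (ap clear z)) σ  ≈⟨ +-congˡ (∂h σ) ⟩
         ap (∂ₗ n) (ap part z) σ ⊕ (z σ ∸ ap (∂ₗ n) (ap part z) σ)  ≈⟨ +-comm _ _ ⟩
         (z σ ∸ ap (∂ₗ n) (ap part z) σ) ⊕ ap (∂ₗ n) (ap part z) σ  ≈⟨ x∸y⊕y≈x _ _ ⟩
         z σ ∎

    down : Bound P′ k → Bound P k
    down (φ , h , bd) = φ , clear ∘ₗ h , λ z s ∂z φz →
      let (s′ , ∂h) = bd z (Supp-⊆ P⊆P′ s) ∂z φz
      in Supp-clear (ap h z) s′ (λ σ d → trans (∂h σ) (s σ (proj₂ d)))
       , λ σ → trans (∂-clear (ap h z) σ) (∂h σ)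

  -- One extra cell costs at most one functional in either direction. Going up it reads the
  -- coefficient at `p` of the cycle, going down that of the chosen bounding chain; once this is
  -- zero, the chain lies in `P`.
  module Point {P P′ : Subset n → Set} (P⊆P′ : P ⊆ P′)
               (p : Subset n) (P′⊆ : ∀ σ → P′ σ → P σ ⊎ σ ≡ p) where

    Supp-point : ∀ {z} → Supp P′ z → z p ≈ 0# → Supp P z
    Supp-point s zp σ ¬p with ≡-dec _≟ᵇ_ σ p
    ... | yes ≡.refl = zp
    ... | no σ≢p     = s σ ([ ¬p , σ≢p ]′ ∘ P′⊆ σ)

    up : Bound P k → Bound P′ (suc k)
    up (φ , h , bd) = consₗ p idₗ φ , h , λ z s ∂z φz →
      let (s′ , ∂h) = bd z (Supp-point s (φz zero)) ∂z (φz ∘ suc)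
      in Supp-⊆ P⊆P′ s′ , ∂h

    down : Bound P′ k → Bound P (suc k)
    down (φ , h , bd) = consₗ p h φ , h , λ z s ∂z φz →
      let (s′ , ∂h) = bd z (Supp-⊆ P⊆P′ s) ∂z (φz ∘ suc)
      in Supp-point s′ (φz zero) , ∂h

  bound-∅ : Bound {n} (λ _ → ⊥) 0
  bound-∅ = zeroₗ , zeroₗ , λ z s _ _ → (λ _ _ → refl) ,
    λ σ → trans (ap-0 (∂ₗ _) (λ _ → refl) σ) (sym (s σ λ ()))

  wedge-∂ : ∀ (v : Fin n) z → (∀ σ → ap (∂ₗ n) z σ ≈ 0#) → ∀ σ → ap (∂ₗ n) (ap (wedge v) z) σ ≈ z σ
  wedge-∂ v z ∂z σ = trans (sym (+-identityʳ _)) (trans (+-congˡ (sym (ap-0 (wedge v) ∂z σ))) (∂-wedge v z σ))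

  bound-full : {P : Subset (suc n) → Set} → (∀ σ → P σ) → Bound P 0
  bound-full all = zeroₗ , wedge zero , λ z s ∂z _ → (λ σ ¬p → ⊥-elim (¬p (all σ))) , wedge-∂ zero z ∂z

  -- Agreement of the two boundary operators

  mutual
    -- The left-hand side is the counting function local to countBelow.  It cannot be named here, so it
    -- is found by unification from count-local-instance.  That this determines it for all arguments
    -- of countBelow rests on conversion ignoring the arguments which the local function does not use.
    count-local : ∀ {m} (p : Fin m → Bool) → _ ≡ countFin p

    count-local-instance : countBelow (replicate (suc n) false) zero ≡
                           countFin (λ (u : Fin n) → memb u (replicate n false) ∧ ⌊ suc u <? zero {n} ⌋)
    count-local-instance {n} with (λ (u : Fin n) → memb u (replicate n false) ∧ ⌊ suc u <? zero {n} ⌋)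
    ... | p = count-local p

    count-local {zero}  p = ≡.refl
    count-local {suc m} p = cong₂ _+_ ≡.refl (count-local (λ i → p (suc i)))

  countBelow≡ : ∀ (τ : Subset n) v → countBelow τ v ≡ countFin (λ u → memb u τ ∧ does (u <? v))
  countBelow≡ τ v = ≡.trans (count-local (λ u → memb u τ ∧ ⌊ u <? v ⌋))
                            (countFin-cong λ u → cong (memb u τ ∧_) (isYes≗does (u <? v)))

  countBelow-zero : ∀ b (τ : Subset n) → countBelow (b ∷ τ) zero ≡ 0
  countBelow-zero {n} b τ = ≡.trans (countBelow≡ (b ∷ τ) zero)
    (≡.trans (countFin-cong {q = λ _ → false} λ u → ∧-zeroʳ (memb u (b ∷ τ))) (countFin-false (suc n)))

  countBelow-suc : ∀ b (τ : Subset n) v → countBelow (b ∷ τ) (suc v) ≡ (if b then 1 else 0) + countBelow τ v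
  countBelow-suc b τ v = ≡.trans (countBelow≡ (b ∷ τ) (suc v))
    (cong₂ (λ b k → (if b then 1 else 0) + k) (∧-identityʳ b) (≡.sym (countBelow≡ τ v)))

  sumFin-cong : ∀ {d} {f g : Fin d → Carrier} → (∀ i → f i ≈ g i) → sumFin f ≈ sumFin g
  sumFin-cong {zero}  e = refl
  sumFin-cong {suc d} e = +-cong (e zero) (sumFin-cong (e ∘ suc))

  sumFin-0 : ∀ {d} {f : Fin d → Carrier} → (∀ i → f i ≈ 0#) → sumFin f ≈ 0#
  sumFin-0 {zero}  e = refl
  sumFin-0 {suc d} e = ⊕-zero (e zero) (sumFin-0 (e ∘ suc))

  sumFin-⊕ : ∀ {d} (f g : Fin d → Carrier) → sumFin (λ i → f i ⊕ g i) ≈ sumFin f ⊕ sumFin g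
  sumFin-⊕ {zero}  f g = sym (+-identityˡ 0#)
  sumFin-⊕ {suc d} f g = trans (+-congˡ (sumFin-⊕ (f ∘ suc) (g ∘ suc))) (interchange _ _ _ _)

  sumFin-⊗ : ∀ {d} s (f : Fin d → Carrier) → sumFin (λ i → s ⊗ f i) ≈ s ⊗ sumFin f
  sumFin-⊗ {zero}  s f = sym (zeroʳ s)
  sumFin-⊗ {suc d} s f = trans (+-congˡ (sumFin-⊗ s (f ∘ suc))) (sym (distribˡ s _ _))

  sumFin-⊖ : ∀ {d} (f : Fin d → Carrier) → sumFin (λ i → ⊖ f i) ≈ ⊖ sumFin f
  sumFin-⊖ {zero}  f = sym -0#≈0#
  sumFin-⊖ {suc d} f = trans (+-congˡ (sumFin-⊖ (f ∘ suc))) (-‿+-comm _ _)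

  -- A first vertex in τ raises every later `countBelow` by one, which is the minus sign of the
  -- recursive form.
  ∂≈∂ₗ : ∀ n (x : Chain n) τ → ∂ x τ ≈ ap (∂ₗ n) x τ
  ∂≈∂ₗ zero    x []          = refl
  ∂≈∂ₗ (suc n) x (false ∷ τ) = +-cong
    (reflexive (cong (λ k → signed k (x (true ∷ τ))) (countBelow-zero false τ)))
    (trans (sumFin-cong {n} λ v → reflexive (cong (λ k → if memb v τ then 0# else signed k (x (false ∷ τ [ v ]≔ inside)))
                                              (countBelow-suc false τ v)))
           (∂≈∂ₗ n (λ σ → x (false ∷ σ)) τ))
  ∂≈∂ₗ (suc n) x (true ∷ τ) = begin
    0# ⊕ sumFin (λ v → if memb v τ then 0# else signed (countBelow (true ∷ τ) (suc v)) (x (true ∷ τ [ v ]≔ inside)))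
      ≈⟨ +-identityˡ _ ⟩
    sumFin (λ v → if memb v τ then 0# else signed (countBelow (true ∷ τ) (suc v)) (x (true ∷ τ [ v ]≔ inside)))
      ≈⟨ sumFin-cong {n} (λ v → trans (reflexive (cong (λ k → if memb v τ then 0# else signed k (x (true ∷ τ [ v ]≔ inside)))
                                                   (countBelow-suc true τ v)))
                                  (pull (memb v τ) _)) ⟩
    sumFin (λ v → ⊖ (if memb v τ then 0# else signed (countBelow τ v) (x (true ∷ τ [ v ]≔ inside))))
      ≈⟨ sumFin-⊖ {n} _ ⟩
    ⊖ ∂ (λ σ → x (true ∷ σ)) τ
      ≈⟨ -‿cong (∂≈∂ₗ n _ τ) ⟩
    ⊖ ap (∂ₗ n) (λ σ → x (true ∷ σ)) τ ∎
    where
    pull : ∀ b y → (if b then 0# else ⊖ y) ≈ ⊖ (if b then 0# else y)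
    pull true  y = sym -0#≈0#
    pull false y = refl

  -- Linear systems over a field without decidable equality

  -- The one-point codomain turns a functional into a `Lin`, so that derived laws such as `ap-∸`
  -- apply to it.
  dot : ∀ {d} → (Fin d → Carrier) → Lin (Fin d) ⊤
  dot {d} a = record
    { ap      = λ x _ → sumFin (λ l → a l ⊗ x l)
    ; ap-cong = λ e _ → sumFin-cong {d} λ l → *-congˡ (e l)
    ; ap-⊕    = λ x y _ → trans (sumFin-cong {d} λ l → distribˡ (a l) _ _) (sumFin-⊕ {d} _ _)
    ; ap-⊗    = λ s x _ → trans (sumFin-cong {d} λ l → swapˡ (a l) s (x l)) (sumFin-⊗ {d} s _) }
    where
    swapˡ : ∀ x y z → x ⊗ (y ⊗ z) ≈ y ⊗ (x ⊗ z)
    swapˡ x y z = trans (sym (*-assoc x y z)) (trans (*-congʳ (*-comm x y)) (*-assoc y x z))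

  sumFin-punchIn : ∀ {d} i (f : Fin (suc d) → Carrier) → sumFin f ≈ f i ⊕ sumFin (f ∘ punchIn i)
  sumFin-punchIn         zero    f = refl
  sumFin-punchIn {suc d} (suc i) f = begin
    f zero ⊕ sumFin (f ∘ suc)  ≈⟨ +-congˡ (sumFin-punchIn i (f ∘ suc)) ⟩
    f zero ⊕ (f (suc i) ⊕ sumFin (f ∘ suc ∘ punchIn i)) ≈⟨ sym (+-assoc _ _ _) ⟩
    (f zero ⊕ f (suc i)) ⊕ sumFin (f ∘ suc ∘ punchIn i) ≈⟨ +-congʳ (+-comm _ _) ⟩
    (f (suc i) ⊕ f zero) ⊕ sumFin (f ∘ suc ∘ punchIn i) ≈⟨ +-assoc _ _ _ ⟩
    f (suc i) ⊕ (f zero ⊕ sumFin (f ∘ suc ∘ punchIn i)) ∎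

  -- Double negation commutes with finite conjunction; this replaces deciding whether a row of a
  -- matrix is zero.
  ¬¬-∀Fin : ∀ {a d} {Q : Fin d → Set a} → (∀ i → ¬ ¬ Q i) → ¬ ¬ (∀ i → Q i)
  ¬¬-∀Fin {d = zero}  h k = k λ ()
  ¬¬-∀Fin {d = suc d} h k = h zero λ q₀ → ¬¬-∀Fin (h ∘ suc) λ q → k λ { zero → q₀ ; (suc i) → q i }

  TrivialKernel : ∀ {d} → (Fin k → Fin d → Carrier) → Set (c ⊔ ℓ)
  TrivialKernel {d = d} M = ∀ (a : Fin d → Carrier) → (∀ i → sumFin (λ l → a l ⊗ M i l) ≈ 0#) → ∀ l → a l ≈ 0#

  -- By induction on the rows. A nonzero entry of the first row is a pivot, and elimination leads to
  -- a contradiction. So no entry of that row is nonzero; as the goal is itself a contradiction, all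
  -- of them may be taken to be zero, and the row is dropped.
  wide-kernel : ∀ {k d} → k < d → (M : Fin k → Fin d → Carrier) → ¬ TrivialKernel M
  wide-kernel {zero} {suc d} _ M triv = 0≉1 (sym (triv (λ _ → 1#) (λ ()) zero))
  wide-kernel {suc k} {suc d} (s≤s k<d) M triv =
    ¬¬-∀Fin (λ l M₀l≉0 → eliminate l M₀l≉0) λ M₀≈0 →
    wide-kernel (ℕP.m<n⇒m<1+n k<d) (M ∘ suc) λ a Ma → triv a λ
      { zero    → sumFin-0 {suc d} {λ l → a l ⊗ M zero l} (λ l → trans (*-congˡ (M₀≈0 l)) (zeroʳ _))
      ; (suc i) → Ma i }
    where
    eliminate : ∀ l → ¬ ¬ (M zero l ≈ 0#)
    eliminate l₀ M₀≉0 = wide-kernel k<d N λ a Na l →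
      trans (reflexive (≡.sym (insertAt-punchIn a l₀ (⊖ (u ⊗ t a)) l))) (triv (extend a) (kernel a Na) (punchIn l₀ l))
      where
      -- `u` inverts the pivot and `N` is the matrix after elimination of column `l₀`. A kernel
      -- vector of `N` is completed at `l₀` by -ut, the value forced by the first row.
      u = proj₁ (inverse (M zero l₀) M₀≉0)
      s = λ i → M (suc i) l₀ ⊗ u
      N : Fin k → Fin d → Carrier
      N i l = M (suc i) (punchIn l₀ l) ∸ s i ⊗ M zero (punchIn l₀ l)
      module _ (a : Fin d → Carrier) where
        t = sumFin (λ l → a l ⊗ M zero (punchIn l₀ l))
        extend = insertAt a l₀ (⊖ (u ⊗ t))
        row : ∀ i → sumFin (λ l → extend l ⊗ M i l) ≈
                    ⊖ (u ⊗ t) ⊗ M i l₀ ⊕ sumFin (λ l → a l ⊗ M i (punchIn l₀ l))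
        row i = trans (sumFin-punchIn l₀ (λ l → extend l ⊗ M i l)) (+-cong
          (*-congʳ (reflexive (insertAt-lookup a l₀ (⊖ (u ⊗ t)))))
          (sumFin-cong {d} λ l → *-congʳ (reflexive (insertAt-punchIn a l₀ (⊖ (u ⊗ t)) l))))
        kernel : (∀ i → sumFin (λ l → a l ⊗ N i l) ≈ 0#) → ∀ i → sumFin (λ l → extend l ⊗ M i l) ≈ 0#
        kernel Na zero = begin
          sumFin (λ l → extend l ⊗ M zero l) ≈⟨ row zero ⟩
          ⊖ (u ⊗ t) ⊗ M zero l₀ ⊕ t ≈⟨ +-congʳ (sym (-‿distribˡ-* _ _)) ⟩
          ⊖ ((u ⊗ t) ⊗ M zero l₀) ⊕ t ≈⟨ +-congʳ (-‿cong (trans (*-comm _ _) (sym (*-assoc _ _ _)))) ⟩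
          ⊖ ((M zero l₀ ⊗ u) ⊗ t) ⊕ t ≈⟨ +-congʳ (-‿cong (trans (*-congʳ (proj₂ (inverse (M zero l₀) M₀≉0))) (*-identityˡ t))) ⟩
          ⊖ t ⊕ t ≈⟨ -‿inverseˡ t ⟩
          0# ∎
        kernel Na (suc i) = begin
          sumFin (λ l → extend l ⊗ M (suc i) l) ≈⟨ row (suc i) ⟩
          ⊖ (u ⊗ t) ⊗ M (suc i) l₀ ⊕ y ≈⟨ +-comm _ _ ⟩
          y ⊕ ⊖ (u ⊗ t) ⊗ M (suc i) l₀ ≈⟨ +-congˡ (sym (-‿distribˡ-* _ _)) ⟩
          y ∸ (u ⊗ t) ⊗ M (suc i) l₀ ≈⟨ ∸-cong refl (trans (*-comm _ _) (sym (*-assoc _ _ _))) ⟩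
          y ∸ s i ⊗ t ≈⟨ ∸-cong refl (sym (ap-⊗ (dot a) (s i) _ tt)) ⟩
          y ∸ ap (dot a) (λ l → s i ⊗ M zero (punchIn l₀ l)) tt ≈⟨ sym (ap-∸ (dot a) _ _ tt) ⟩
          sumFin (λ l → a l ⊗ N i l) ≈⟨ Na i ⟩
          0# ∎
          where y = sumFin (λ l → a l ⊗ M (suc i) (punchIn l₀ l))

  -- From bounds to the total Betti number

  sumFin-+ : ∀ a {b} (f : Fin (a + b) → Carrier) → sumFin f ≈ sumFin (f ∘ (_↑ˡ b)) ⊕ sumFin (f ∘ (a ↑ʳ_))
  sumFin-+ zero    f = sym (+-identityˡ _)
  sumFin-+ (suc a) f = trans (+-congˡ (sumFin-+ a (f ∘ suc))) (sym (+-assoc _ _ _))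

  IsFace : Complex n → Subset n → Set
  IsFace K σ = face K σ ≡ true

  -- The bounding chains that `Bound` supplies mix degrees. By homogeneity of the boundary, the part
  -- of `w` in cardinality `suc j` already bounds `y`.
  homogeneous-boundary : ∀ {K : Complex n} {j} {w y : Chain n} → Supp (IsFace K) w →
    (∀ σ → ∣ σ ∣ ≢ j → y σ ≈ 0#) → (∀ σ → ∣ σ ∣ ≡ j → y σ ≈ ap (∂ₗ n) w σ) → IsBoundary K j y
  homogeneous-boundary {n} {K} {j} {w} {y} sw y-off y-on = ap (keep degree?) w , supp , bd
    where
    degree? : Decidable (λ σ → ∣ σ ∣ ≡ suc j)
    degree? σ = ∣ σ ∣ ℕ.≟ suc j
    supp : IsChain K (suc j) (ap (keep degree?) w)
    supp σ ¬c with degree? σ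
    ... | yes e = trans (keep-in degree? w e) (sw σ λ f → ¬c (f , e))
    ... | no ¬e = keep-out degree? w ¬e
    bd : ∀ τ → ∂ (ap (keep degree?) w) τ ≈ y τ
    bd τ = trans (∂≈∂ₗ n _ τ) (trans (∂-degree n (λ i → does (i ℕ.≟ suc j)) w τ) (by-degree (∣ τ ∣ ℕ.≟ j)))
      where
      by-degree : Dec (∣ τ ∣ ≡ j) → (if does (suc ∣ τ ∣ ℕ.≟ suc j) then ap (∂ₗ n) w τ else 0#) ≈ y τ
      by-degree (yes e) rewrite dec-true  (suc ∣ τ ∣ ℕ.≟ suc j) (cong suc e) = sym (y-on τ e)
      by-degree (no ¬e) rewrite dec-false (suc ∣ τ ∣ ℕ.≟ suc j) (¬e ∘ ℕP.suc-injective) = sym (y-off τ ¬e)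

  module Total (K : Complex n) (β : ℕ → ℕ) (basis : ∀ j → Fin (β j) → Chain n)
               (basis-supp : ∀ j l → IsChain K j (basis j l))
               (basis-∂ : ∀ j l τ → ∂ (basis j l) τ ≈ 0#)
               (basis-indep : ∀ j → IndependentModBoundaries K j (basis j)) where

    total : ∀ j → Fin (sumUpTo j β) → Chain n
    total zero    = basis zero
    total (suc j) = [ total j , basis (suc j) ]′ ∘ splitAt (sumUpTo j β)

    total-cycle : ∀ j l → Supp (IsFace K) (total j l) × (∀ σ → ap (∂ₗ n) (total j l) σ ≈ 0#)
    total-cycle zero    l = (λ σ ¬f → basis-supp zero l σ (¬f ∘ proj₁)) ,
      λ σ → trans (sym (∂≈∂ₗ n _ σ)) (basis-∂ zero l σ)
    total-cycle (suc j) l with splitAt (sumUpTo j β) l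
    ... | inj₁ l′ = total-cycle j l′
    ... | inj₂ l′ = (λ σ ¬f → basis-supp (suc j) l′ σ (¬f ∘ proj₁)) ,
      λ σ → trans (sym (∂≈∂ₗ n _ σ)) (basis-∂ (suc j) l′ σ)

    total-degree : ∀ j l σ → j < ∣ σ ∣ → total j l σ ≈ 0#
    total-degree zero    l σ 0<σ = basis-supp zero l σ λ { (_ , e) → ℕP.<-irrefl (≡.sym e) 0<σ }
    total-degree (suc j) l σ j<σ with splitAt (sumUpTo j β) l
    ... | inj₁ l′ = total-degree j l′ σ (ℕP.<-trans (ℕP.n<1+n j) j<σ)
    ... | inj₂ l′ = basis-supp (suc j) l′ σ λ { (_ , e) → ℕP.<-irrefl (≡.sym e) j<σ }

    basis-off : ∀ j a σ → ∣ σ ∣ ≢ j → lincomb a (basis j) σ ≈ 0#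
    basis-off j a σ ≢j = sumFin-0 {β j} λ l → trans (*-congˡ (basis-supp j l σ (≢j ∘ proj₂))) (zeroʳ _)

    -- Only cardinalities up to j are constrained, so the same `w` serves in the induction: in
    -- smaller cardinalities the last basis contributes nothing, and in cardinality `suc j` nothing
    -- else does.
    total-independent : ∀ j (a : Fin (sumUpTo j β) → Carrier) w → Supp (IsFace K) w →
      (∀ σ → ∣ σ ∣ ≤ j → lincomb a (total j) σ ≈ ap (∂ₗ n) w σ) → ∀ l → a l ≈ 0#
    total-independent zero a w sw e =
      basis-indep zero a
        (homogeneous-boundary {K = K} {w = w} sw (basis-off zero a) λ σ σ≡0 → e σ (ℕP.≤-reflexive σ≡0))
    total-independent (suc j) a w sw e l =
      trans (reflexive (cong a (≡.sym (join-splitAt b _ l)))) (zero-at (splitAt b l))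
      where
      b = sumUpTo j β
      a₁ = λ l → a (l ↑ˡ β (suc j))
      a₂ = λ l → a (b ↑ʳ l)
      split : ∀ σ → lincomb a (total (suc j)) σ ≈ lincomb a₁ (total j) σ ⊕ lincomb a₂ (basis (suc j)) σ
      split σ = trans (sumFin-+ b (λ l → a l ⊗ total (suc j) l σ)) (+-cong
        (sumFin-cong {b} λ l → *-congˡ (reflexive (cong (λ s → [ total j , basis (suc j) ]′ s σ) (splitAt-↑ˡ b l (β (suc j))))))
        (sumFin-cong {β (suc j)} λ l → *-congˡ (reflexive (cong (λ s → [ total j , basis (suc j) ]′ s σ) (splitAt-↑ʳ b (β (suc j)) l)))))
      low : ∀ l → a₁ l ≈ 0#
      low = total-independent j a₁ w sw λ σ σ≤j → begin
        lincomb a₁ (total j) σ  ≈⟨ sym (+-identityʳ _) ⟩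
        lincomb a₁ (total j) σ ⊕ 0#
          ≈⟨ +-congˡ (sym (basis-off (suc j) a₂ σ λ σ≡ → ℕP.1+n≰n (subst (_≤ j) σ≡ σ≤j))) ⟩
        lincomb a₁ (total j) σ ⊕ lincomb a₂ (basis (suc j)) σ  ≈⟨ sym (split σ) ⟩
        lincomb a (total (suc j)) σ  ≈⟨ e σ (ℕP.m≤n⇒m≤1+n σ≤j) ⟩
        ap (∂ₗ n) w σ ∎
      high : ∀ l → a₂ l ≈ 0#
      high = basis-indep (suc j) a₂
        (homogeneous-boundary {K = K} {w = w} sw (basis-off (suc j) a₂) λ σ σ≡ → begin
        lincomb a₂ (basis (suc j)) σ  ≈⟨ sym (+-identityˡ _) ⟩
        0# ⊕ lincomb a₂ (basis (suc j)) σ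
          ≈⟨ +-congʳ (sym (sumFin-0 {b} λ l → trans (*-congˡ (total-degree j l σ (ℕP.≤-reflexive (≡.sym σ≡)))) (zeroʳ _))) ⟩
        lincomb a₁ (total j) σ ⊕ lincomb a₂ (basis (suc j)) σ  ≈⟨ sym (split σ) ⟩
        lincomb a (total (suc j)) σ  ≈⟨ e σ (ℕP.≤-reflexive σ≡) ⟩
        ap (∂ₗ n) w σ ∎)
      zero-at : ∀ s → a (join b (β (suc j)) s) ≈ 0#
      zero-at (inj₁ l) = low l
      zero-at (inj₂ l) = high l

  -- If b > k, evaluate the k functionals on the b basis cycles. A combination killed by all of them
  -- bounds, hence has zero coefficients, so a matrix with more columns than rows would have trivial
  -- kernel.
  totalBetti≤ : ∀ {K : Complex n} {b k} → TotalBetti K b → Bound (IsFace K) k → b ≤ k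
  totalBetti≤ {n} {K} {b} {k} (β , H , ≡.refl) (φ , h , bd) with b ℕ.≤? k
  ... | yes b≤k = b≤k
  ... | no  b≰k = ⊥-elim (wide-kernel (ℕP.≰⇒> b≰k) (λ i l → ap φ (total n l) i) λ a φa →
    let y = lincomb a (total n)
        (sw , ∂w) = bd y
          (λ σ ¬f → sumFin-0 {b} λ l → trans (*-congˡ (proj₁ (total-cycle n l) σ ¬f)) (zeroʳ _))
          (λ σ → trans (ap-sum (∂ₗ n) a (total n) σ)
                       (sumFin-0 {b} λ l → trans (*-congˡ (proj₂ (total-cycle n l) σ)) (zeroʳ _)))
          (λ i → trans (ap-sum φ a (total n) i) (φa i))
    in total-independent n a (ap h y) sw λ σ _ → sym (∂w σ))
    where
    open Total K β (λ j → proj₁ (proj₁ (H j))) (λ j l → proj₁ (proj₁ (proj₂ (proj₁ (H j))) l))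
                   (λ j l → proj₂ (proj₁ (proj₂ (proj₁ (H j))) l)) (λ j → proj₂ (proj₂ (proj₁ (H j))))

-- Powers of a rational number above Γ

fromℕ : ℕ → ℚ
fromℕ k = ℤ.+ k ℚ./ 1

fromℕ-+ : ∀ a b → fromℕ (a + b) ≡ fromℕ a ℚ.+ fromℕ b
fromℕ-+ a b = ≡.trans
  (cong (ℚ._/ 1) (≡.sym (cong₂ ℤ._+_ (ℤP.*-identityʳ (ℤ.+ a)) (ℤP.*-identityʳ (ℤ.+ b)))))
  (≡.sym (cong₂ ℚ._+_ (integral a) (integral b)))
  where
  integral : ∀ k → fromℕ k ≡ mkℚ (ℤ.+ k) 0 (coprime-sym (1-coprimeTo k))
  integral k = ℚP.normalize-coprime (coprime-sym (1-coprimeTo k))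

0≤fromℕ : ∀ k → 0ℚ ℚ.≤ fromℕ k
0≤fromℕ k = ℚP.nonNegative⁻¹ _ {{ℚP.normalize-nonNeg k 1}}

p≤p+q : ∀ p {q} → 0ℚ ℚ.≤ q → p ℚ.≤ p ℚ.+ q
p≤p+q p {q} 0≤q = subst (ℚ._≤ p ℚ.+ q) (ℚP.+-identityʳ p) (ℚP.+-monoʳ-≤ p 0≤q)

fromℕ-mono : ∀ {a b} → a ≤ b → fromℕ a ℚ.≤ fromℕ b
fromℕ-mono {a} a≤b with ℕP.m≤n⇒∃[o]m+o≡n a≤b
... | o , ≡.refl = subst (fromℕ a ℚ.≤_) (≡.sym (fromℕ-+ a o)) (p≤p+q _ (0≤fromℕ o))

powℚ-+ : ∀ r a b → powℚ r (a + b) ≡ powℚ r a ℚ.* powℚ r b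
powℚ-+ r zero    b = ≡.sym (ℚP.*-identityˡ _)
powℚ-+ r (suc a) b = ≡.trans (cong (r ℚ.*_) (powℚ-+ r a b)) (≡.sym (ℚP.*-assoc r _ _))

powℚ-square : ∀ r n → powℚ (powℚ r 2) n ≡ powℚ r (n + n)
powℚ-square r zero    = ≡.refl
powℚ-square r (suc n) = ≡.trans (cong (powℚ r 2 ℚ.*_) (powℚ-square r n))
  (≡.trans (solve 2 (λ r p → (r :* (r :* con 1ℚ)) :* p := r :* (r :* p)) ≡.refl r (powℚ r (n + n)))
           (cong (λ k → r ℚ.* powℚ r k) (≡.sym (ℕP.+-suc n n))))

*-0≤ : ∀ {p q} → 0ℚ ℚ.≤ p → 0ℚ ℚ.≤ q → 0ℚ ℚ.≤ p ℚ.* q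
*-0≤ {p} {q} 0≤p 0≤q = ℚP.nonNegative⁻¹ _ {{ℚP.nonNeg*nonNeg⇒nonNeg p {{ℚ.nonNegative 0≤p}} q {{ℚ.nonNegative 0≤q}}}}

+-0≤ : ∀ {p q} → 0ℚ ℚ.≤ p → 0ℚ ℚ.≤ q → 0ℚ ℚ.≤ p ℚ.+ q
+-0≤ = ℚP.+-mono-≤

0≤q-p⇒p≤q : ∀ {p q} → 0ℚ ℚ.≤ q ℚ.- p → p ℚ.≤ q
0≤q-p⇒p≤q {p} {q} h = subst (p ℚ.≤_) (solve 2 (λ p q → p :+ (q :- p) := q) ≡.refl p q) (p≤p+q p h)

p<q⇒0<q-p : ∀ {p q} → p ℚ.< q → 0ℚ ℚ.< q ℚ.- p
p<q⇒0<q-p {p} {q} h = subst (ℚ._< q ℚ.- p) (ℚP.+-inverseʳ p) (ℚP.+-monoˡ-< (ℚ.- p) h)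

module Numbers (r : ℚ) (above : AboveΓ r) where

  private
    0<r : 0ℚ ℚ.< r
    0<r = proj₁ above

    0≤r : 0ℚ ℚ.≤ r
    0≤r = ℚP.<⇒≤ 0<r

    s = r ℚ.- 1ℚ

    q : ℚ
    q = r ℚ.* r ℚ.* (r ℚ.* r ℚ.+ 1ℚ) ℚ.* s ℚ.- 1ℚ

    -- r⁶ − r² − r − 1 factors as (r + 1) q.
    0<q : 0ℚ ℚ.< q
    0<q = ℚP.*-cancelˡ-<-nonNeg (r ℚ.+ 1ℚ) {{ℚ.nonNegative (+-0≤ 0≤r (0≤fromℕ 1))}}
      (subst (ℚ._< (r ℚ.+ 1ℚ) ℚ.* q) (≡.sym (ℚP.*-zeroʳ (r ℚ.+ 1ℚ)))
        (subst (0ℚ ℚ.<_)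
          (solve 1 (λ r → r :* (r :* (r :* (r :* (r :* (r :* con 1ℚ))))) :- (r :* (r :* con 1ℚ) :+ r :+ con 1ℚ)
                          := (r :+ con 1ℚ) :* (r :* r :* (r :* r :+ con 1ℚ) :* (r :- con 1ℚ) :- con 1ℚ)) ≡.refl r)
          (p<q⇒0<q-p (proj₂ above))))

    -- `AboveΓ` only says that r is positive. For r < 1 the product in `q` would be at most 0,
    -- contradicting 0 < q.
    0≤s : 0ℚ ℚ.≤ s
    0≤s with 0ℚ ℚ.≤? s
    ... | yes 0≤s = 0≤s
    ... | no  0≰s = ⊥-elim (ℚP.<-irrefl ≡.refl (ℚP.<-≤-trans 0<q
      (ℚP.≤-trans (ℚP.+-monoˡ-≤ (ℚ.- 1ℚ) ts≤0) (ℚP.toℚᵘ-cancel-≤ (ℚᵘ.*≤* ℤ.-≤+)))))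
      where
      t = r ℚ.* r ℚ.* (r ℚ.* r ℚ.+ 1ℚ)
      0≤t : 0ℚ ℚ.≤ t
      0≤t = *-0≤ (*-0≤ 0≤r 0≤r) (+-0≤ (*-0≤ 0≤r 0≤r) (0≤fromℕ 1))
      ts≤0 : t ℚ.* s ℚ.≤ 0ℚ
      ts≤0 = subst (t ℚ.* s ℚ.≤_) (ℚP.*-zeroʳ t)
               (ℚP.*-monoˡ-≤-nonNeg t {{ℚ.nonNegative 0≤t}} (ℚP.<⇒≤ (ℚP.≰⇒> 0≰s)))

    0≤q : 0ℚ ℚ.≤ q
    0≤q = ℚP.<⇒≤ 0<q

    1≤r : 1ℚ ℚ.≤ r
    1≤r = 0≤q-p⇒p≤q 0≤s

    -- This is 1 + r^d ≤ r^(d+2) at d = 3, the start of `1+pow≤`. The difference is `q` plus a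
    -- square.
    1+r³≤r⁵ : 1ℚ ℚ.+ powℚ r 3 ℚ.≤ powℚ r 5
    1+r³≤r⁵ = 0≤q-p⇒p≤q (subst (0ℚ ℚ.≤_)
      (solve 1 (λ r → (r :* r :* (r :* r :+ con 1ℚ) :* (r :- con 1ℚ) :- con 1ℚ) :+ r :* r :* ((r :- con 1ℚ) :* (r :- con 1ℚ))
                      := r :* (r :* (r :* (r :* (r :* con 1ℚ)))) :- (con 1ℚ :+ r :* (r :* (r :* con 1ℚ)))) ≡.refl r)
      (+-0≤ 0≤q (*-0≤ (*-0≤ 0≤r 0≤r) (*-0≤ 0≤s 0≤s))))

    1+r≤r⁴ : 1ℚ ℚ.+ powℚ r 1 ℚ.≤ powℚ r 4
    1+r≤r⁴ = ℚP.*-cancelˡ-≤-pos r {{ℚ.positive 0<r}} (0≤q-p⇒p≤q (subst (0ℚ ℚ.≤_)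
      (solve 1 (λ r → (r :* r :* (r :* r :+ con 1ℚ) :* (r :- con 1ℚ) :- con 1ℚ)
                        :+ (r :- con 1ℚ) :* ((r :- con 1ℚ) :* (r :* r :+ r :+ con 1ℚ))
                      := r :* (r :* (r :* (r :* (r :* con 1ℚ)))) :- r :* (con 1ℚ :+ r :* con 1ℚ)) ≡.refl r)
      (+-0≤ 0≤q (*-0≤ 0≤s (*-0≤ 0≤s (+-0≤ (+-0≤ (*-0≤ 0≤r 0≤r) 0≤r) (0≤fromℕ 1)))))))

  0<pow : ∀ k → 0ℚ ℚ.< powℚ r k
  0<pow zero    = ℚP.positive⁻¹ 1ℚ
  0<pow (suc k) = ℚP.positive⁻¹ _ {{ℚP.pos*pos⇒pos r {{ℚ.positive 0<r}} _ {{ℚ.positive (0<pow k)}}}}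

  *-pow-≤ : ∀ k {p q} → p ℚ.≤ q → powℚ r k ℚ.* p ℚ.≤ powℚ r k ℚ.* q
  *-pow-≤ k = ℚP.*-monoˡ-≤-nonNeg (powℚ r k) {{ℚ.nonNegative (ℚP.<⇒≤ (0<pow k))}}

  1≤pow : ∀ k → 1ℚ ℚ.≤ powℚ r k
  1≤pow zero    = ℚP.≤-refl
  1≤pow (suc k) = ℚP.≤-trans 1≤r (subst (ℚ._≤ r ℚ.* powℚ r k) (ℚP.*-identityʳ r)
    (ℚP.*-monoˡ-≤-nonNeg r {{ℚ.nonNegative 0≤r}} (1≤pow k)))

  pow-mono : ∀ {a b} → a ≤ b → powℚ r a ℚ.≤ powℚ r b
  pow-mono {a} a≤b with ℕP.m≤n⇒∃[o]m+o≡n a≤b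
  ... | o , ≡.refl = subst (powℚ r a ℚ.≤_) (≡.sym (powℚ-+ r a o))
    (subst (ℚ._≤ powℚ r a ℚ.* powℚ r o) (ℚP.*-identityʳ _) (*-pow-≤ a (1≤pow o)))

  geom : ℕ → ℚ
  geom zero    = 0ℚ
  geom (suc l) = geom l ℚ.+ powℚ r l

  0≤geom : ∀ l → 0ℚ ℚ.≤ geom l
  0≤geom zero    = ℚP.≤-refl
  0≤geom (suc l) = +-0≤ (0≤geom l) (ℚP.<⇒≤ (0<pow l))

  private
    1+pow≤ : ∀ k → 1ℚ ℚ.+ powℚ r (3 + k) ℚ.≤ powℚ r (5 + k)
    1+pow≤ zero    = 1+r³≤r⁵
    1+pow≤ (suc k) = ℚP.≤-trans (ℚP.+-monoˡ-≤ (powℚ r (4 + k)) 1≤r)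
      (subst (ℚ._≤ powℚ r (6 + k)) (solve 2 (λ r p → r :* (con 1ℚ :+ p) := r :+ r :* p) ≡.refl r (powℚ r (3 + k)))
        (ℚP.*-monoˡ-≤-nonNeg r {{ℚ.nonNegative 0≤r}} (1+pow≤ k)))

    geom≤-large : ∀ k → geom (3 + k) ℚ.≤ powℚ r ((3 + k) + (3 + k))
    geom≤-large zero    = ℚP.≤-trans (ℚP.≤-reflexive
      (solve 1 (λ r → ((con 0ℚ :+ con 1ℚ) :+ r :* con 1ℚ) :+ r :* (r :* con 1ℚ) := r :* (r :* con 1ℚ) :+ r :+ con 1ℚ) ≡.refl r))
      (ℚP.<⇒≤ (proj₂ above))
    -- r^(2d) + r^d = r^d (1 + r^d) ≤ r^d r^(d+2) by `1+pow≤`.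
    geom≤-large (suc k) = ℚP.≤-trans (ℚP.+-monoˡ-≤ (powℚ r d) (geom≤-large k))
      (subst₂ ℚ._≤_
        (≡.trans (ℚP.*-distribˡ-+ (powℚ r d) 1ℚ (powℚ r d))
          (≡.trans (ℚP.+-comm (powℚ r d ℚ.* 1ℚ) (powℚ r d ℚ.* powℚ r d)) (cong₂ ℚ._+_ (≡.sym (powℚ-+ r d d)) (ℚP.*-identityʳ _))))
        (≡.trans (≡.sym (powℚ-+ r d (2 + d))) (cong (powℚ r) (ℕP.+-suc d (suc d))))
        (*-pow-≤ d (1+pow≤ k)))
      where d = 3 + k

  geom≤ : ∀ d → geom d ℚ.≤ powℚ r (d + d)
  geom≤ 0 = 0≤fromℕ 1
  geom≤ 1 = 1≤pow 2
  geom≤ 2 = subst (ℚ._≤ powℚ r 4) (cong (ℚ._+ powℚ r 1) (≡.sym (ℚP.+-identityˡ 1ℚ))) 1+r≤r⁴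
  geom≤ (suc (suc (suc k))) = geom≤-large k

  -- k ≤ Σ_{1≤i≤l} r^(u−d−i), multiplied by r^(d+l) so that no subtraction occurs.
  Partial : (d l u k : ℕ) → Set
  Partial d l u k = fromℕ k ℚ.* powℚ r (d + l) ℚ.≤ geom l ℚ.* powℚ r u

  partial-zero : ∀ d l u → Partial d l u 0
  partial-zero d l u = subst (ℚ._≤ geom l ℚ.* powℚ r u) (≡.sym (ℚP.*-zeroˡ (powℚ r (d + l))))
    (*-0≤ (0≤geom l) (ℚP.<⇒≤ (0<pow u)))

  -- In the sum of r^(u-d-i) the term i = 1 pays for `k₁`, the branch that contains the current
  -- neighbour and thereby decides at least d + 1 vertices. The other branch has at most u - 1 free
  -- vertices, so its l terms are the remaining ones.
  partial-step : ∀ d l u u₁ u₂ k₁ k₂ → fromℕ k₁ ℚ.≤ powℚ r u₁ → u₁ + d < u →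
                 Partial d l u₂ k₂ → u₂ < u → Partial d (suc l) u (k₁ + k₂)
  partial-step d l u u₁ u₂ k₁ k₂ h₁ u₁<u h₂ u₂<u = begin
    fromℕ (k₁ + k₂) ℚ.* powℚ r (d + suc l)
      ≡⟨ cong₂ ℚ._*_ (fromℕ-+ k₁ k₂) (≡.trans (cong (powℚ r) (ℕP.+-suc d l)) (cong (r ℚ.*_) (powℚ-+ r d l))) ⟩
    (fromℕ k₁ ℚ.+ fromℕ k₂) ℚ.* (r ℚ.* (D ℚ.* L))
      ≡⟨ solve 5 (λ x y r D L → (x :+ y) :* (r :* (D :* L)) := r :* (y :* (D :* L)) :+ (L :* (r :* D)) :* x)
               ≡.refl (fromℕ k₁) (fromℕ k₂) r D L ⟩
    r ℚ.* (fromℕ k₂ ℚ.* (D ℚ.* L)) ℚ.+ (L ℚ.* (r ℚ.* D)) ℚ.* fromℕ k₁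
      ≤⟨ ℚP.+-mono-≤ first second ⟩
    geom l ℚ.* powℚ r u ℚ.+ L ℚ.* powℚ r u
      ≡⟨ ≡.sym (ℚP.*-distribʳ-+ (powℚ r u) (geom l) L) ⟩
    geom (suc l) ℚ.* powℚ r u ∎
    where
    open ℚP.≤-Reasoning
    D = powℚ r d
    L = powℚ r l
    first : r ℚ.* (fromℕ k₂ ℚ.* (D ℚ.* L)) ℚ.≤ geom l ℚ.* powℚ r u
    first = begin
      r ℚ.* (fromℕ k₂ ℚ.* (D ℚ.* L))
        ≤⟨ ℚP.*-monoˡ-≤-nonNeg r {{ℚ.nonNegative 0≤r}} (subst (λ p → fromℕ k₂ ℚ.* p ℚ.≤ _) (powℚ-+ r d l) h₂) ⟩
      r ℚ.* (geom l ℚ.* powℚ r u₂)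
        ≡⟨ solve 3 (λ r g p → r :* (g :* p) := g :* (r :* p)) ≡.refl r (geom l) (powℚ r u₂) ⟩
      geom l ℚ.* powℚ r (suc u₂)
        ≤⟨ ℚP.*-monoˡ-≤-nonNeg (geom l) {{ℚ.nonNegative (0≤geom l)}} (pow-mono u₂<u) ⟩
      geom l ℚ.* powℚ r u ∎
    second : (L ℚ.* (r ℚ.* D)) ℚ.* fromℕ k₁ ℚ.≤ L ℚ.* powℚ r u
    second = begin
      (L ℚ.* (r ℚ.* D)) ℚ.* fromℕ k₁  ≡⟨ ℚP.*-assoc L (r ℚ.* D) (fromℕ k₁) ⟩
      L ℚ.* (powℚ r (suc d) ℚ.* fromℕ k₁)  ≤⟨ *-pow-≤ l (*-pow-≤ (suc d) h₁) ⟩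
      L ℚ.* (powℚ r (suc d) ℚ.* powℚ r u₁)  ≡⟨ cong (L ℚ.*_) (≡.sym (powℚ-+ r (suc d) u₁)) ⟩
      L ℚ.* powℚ r (suc d + u₁)  ≤⟨ *-pow-≤ l (pow-mono (subst (_< u) (ℕP.+-comm u₁ d) u₁<u)) ⟩
      L ℚ.* powℚ r u ∎

  partial-final : ∀ d u k → Partial d d u k → fromℕ k ℚ.≤ powℚ r u
  partial-final d u k h = ℚP.*-cancelˡ-≤-pos (powℚ r (d + d)) {{ℚ.positive (0<pow (d + d))}} (begin
    powℚ r (d + d) ℚ.* fromℕ k  ≡⟨ ℚP.*-comm (powℚ r (d + d)) (fromℕ k) ⟩
    fromℕ k ℚ.* powℚ r (d + d)  ≤⟨ h ⟩
    geom d ℚ.* powℚ r u  ≤⟨ ℚP.*-monoʳ-≤-nonNeg (powℚ r u) {{ℚ.nonNegative (ℚP.<⇒≤ (0<pow u))}} (geom≤ d) ⟩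
    powℚ r (d + d) ℚ.* powℚ r u ∎)
    where open ℚP.≤-Reasoning

-- Independence complexes of triangle-free graphs

ext-memb : ∀ {n} {σ τ : Subset n} → (∀ i → memb i σ ≡ memb i τ) → σ ≡ τ
ext-memb {σ = []}    {[]}    e = ≡.refl
ext-memb {σ = x ∷ σ} {y ∷ τ} e = cong₂ _∷_ (e zero) (ext-memb (e ∘ suc))

memb-tabulate : ∀ {n} (f : Fin n → Bool) i → memb i (tabulate f) ≡ f i
memb-tabulate f zero    = ≡.refl
memb-tabulate f (suc i) = memb-tabulate (f ∘ suc) i

toℕᵇ : Bool → ℕ
toℕᵇ b = if b then 1 else 0

countFin-disjoint : ∀ {m} {p q t : Fin m → Bool} →
  (∀ i → toℕᵇ (p i) + toℕᵇ (q i) ≤ toℕᵇ (t i)) → countFin p + countFin q ≤ countFin t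
countFin-disjoint {zero}              h = z≤n
countFin-disjoint {suc m} {p} {q} {t} h = ℕP.≤-trans
  (ℕP.≤-reflexive (ℕ+.interchange (toℕᵇ (p zero)) _ (toℕᵇ (q zero)) _))
  (ℕP.+-mono-≤ (h zero) (countFin-disjoint (h ∘ suc)))

toℕᵇ-mono : ∀ {a b} → (a ≡ true → b ≡ true) → toℕᵇ a ≤ toℕᵇ b
toℕᵇ-mono {false} h = z≤n
toℕᵇ-mono {true}  h rewrite h ≡.refl = s≤s z≤n

countFin-mono : ∀ {m} {p q : Fin m → Bool} → (∀ i → p i ≡ true → q i ≡ true) → countFin p ≤ countFin q
countFin-mono {zero}  h = z≤n
countFin-mono {suc m} h = ℕP.+-mono-≤ (toℕᵇ-mono (h zero)) (countFin-mono (h ∘ suc))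

countFin-< : ∀ {m} {p q : Fin m → Bool} i → p i ≡ false → q i ≡ true →
             (∀ i → p i ≡ true → q i ≡ true) → countFin p < countFin q
countFin-< zero    pi qi h rewrite pi | qi = s≤s (countFin-mono (h ∘ suc))
countFin-< {suc m} {p} {q} (suc i) pi qi h = ℕP.≤-trans
  (ℕP.≤-reflexive (≡.sym (ℕP.+-suc (toℕᵇ (p zero)) _)))
  (ℕP.+-mono-≤ (toℕᵇ-mono (h zero)) (countFin-< i pi qi (h ∘ suc)))

countFin-true : ∀ m → countFin {m} (λ _ → true) ≡ m
countFin-true zero    = ≡.refl
countFin-true (suc m) = cong suc (countFin-true m)

argmin : ∀ {m} (p : Fin m → Bool) (f : Fin m → ℕ) →
         (∀ i → p i ≡ false) ⊎ ∃ λ v → p v ≡ true × (∀ w → p w ≡ true → f v ≤ f w)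
argmin {zero}  p f = inj₁ λ ()
argmin {suc m} p f with p zero in p₀ | argmin (p ∘ suc) (f ∘ suc)
... | false | inj₁ none = inj₁ λ { zero → p₀ ; (suc i) → none i }
... | false | inj₂ (v , pv , min) = inj₂ (suc v , pv , λ { zero e → contradiction (≡.trans (≡.sym p₀) e) λ () ; (suc w) e → min w e })
... | true  | inj₁ none = inj₂ (zero , p₀ , λ { zero _ → ℕP.≤-refl ; (suc w) e → contradiction (≡.trans (≡.sym (none w)) e) λ () })
... | true  | inj₂ (v , pv , min) with ℕP.≤-total (f zero) (f (suc v))
... | inj₁ f₀≤ = inj₂ (zero , p₀ , λ { zero _ → ℕP.≤-refl ; (suc w) e → ℕP.≤-trans f₀≤ (min w e) })
... | inj₂ ≤f₀ = inj₂ (suc v , pv , λ { zero _ → ≤f₀ ; (suc w) e → min w e })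

-- All that the matching tree needs to know about bounds: `toggle` adds sets that cancel in pairs,
-- `point` adds a critical cell. `Q` stays abstract because the tree is run both for a complex and
-- for its Alexander dual.
record Rules {q : Level} {N : ℕ} (Q : (Subset N → Set) → ℕ → Set q) : Set (Level.suc Level.zero ⊔ q) where
  field
    base   : Q (λ _ → ⊥) 0
    resp   : ∀ {P P′ k} → P ⊆ P′ → P′ ⊆ P → Q P k → Q P′ k
    toggle : ∀ {P P′ k} → Decidable P → Decidable P′ → Lower P → Lower P′ → P ⊆ P′ →
             ∀ v → ToggleClosed v (Diff P′ P) → Q P k → Q P′ k
    point  : ∀ {P P′ k} → P ⊆ P′ → ∀ p → (∀ σ → P′ σ → P σ ⊎ σ ≡ p) → Q P k → Q P′ (suc k)

Independent : ∀ {N} → (Fin N → Fin N → Bool) → Subset N → Set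
Independent adj σ = ∀ i j → memb i σ ≡ true → memb j σ ≡ true → adj i j ≡ false

independent? : ∀ {N} adj → Decidable (Independent {N} adj)
independent? adj σ = all? λ i → all? λ j →
  (memb i σ ≟ᵇ true) →-dec ((memb j σ ≟ᵇ true) →-dec (adj i j ≟ᵇ false))

independent-lower : ∀ {N} adj → Lower (Independent {N} adj)
independent-lower adj σ⊑τ ind i j mi mj = ind i j (σ⊑τ i mi) (σ⊑τ j mj)

true≢false : ∀ {b : Bool} → b ≡ true → b ≢ false
true≢false ≡.refl ()

∧-true⁻ : ∀ {a b} → a ∧ b ≡ true → a ≡ true × b ≡ true
∧-true⁻ {true} e = ≡.refl , e

-- The matching tree

data Status : Set where
  in! out! free : Status

isFree : Status → Bool
isFree free = true
isFree _    = false

isIn : Status → Bool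
isIn in! = true
isIn _   = false

isFree⇒ : ∀ {x} → isFree x ≡ true → x ≡ free
isFree⇒ {free} e = ≡.refl

Agrees : Status → Bool → Set
Agrees in!  b = b ≡ true
Agrees out! b = b ≡ false
Agrees free b = ⊤

agrees? : ∀ x b → Dec (Agrees x b)
agrees? in!  b = b ≟ᵇ true
agrees? out! b = b ≟ᵇ false
agrees? free b = yes tt

module MatchingTree {N : ℕ} (adj : Fin N → Fin N → Bool)
  (adj-sym : ∀ i j → adj i j ≡ adj j i) (adj-irrefl : ∀ i → adj i i ≡ false)
  (triangle-free : ∀ v i j → adj v i ≡ true → adj v j ≡ true → adj i j ≡ false) where

  State : Set
  State = Fin N → Status

  Fam : State → Subset N → Set
  Fam s σ = Independent adj σ × (∀ i → Agrees (s i) (memb i σ))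

  Fam? : ∀ s → Decidable (Fam s)
  Fam? s σ = independent? adj σ ×-dec all? λ i → agrees? (s i) (memb i σ)

  -- Neighbours of chosen vertices are already decided, so a free vertex may be added as soon as its
  -- free neighbours are gone.
  Valid : State → Set
  Valid s = ∀ i j → s i ≡ in! → s j ≡ free → adj i j ≡ false

  infixl 5 _─_ _✚_

  _─_ : State → Fin N → State
  (s ─ w) i with i ≟ w
  ... | yes _ = out!
  ... | no  _ = s i

  absorb : Bool → Status → Status
  absorb true free = out!
  absorb _    x    = x

  _✚_ : State → Fin N → State
  (s ✚ w) i with i ≟ w
  ... | yes _ = in!
  ... | no  _ = absorb (adj w i) (s i)

  absorb-free : ∀ b {x} → absorb b x ≡ free → b ≡ false × x ≡ free
  absorb-free true  {free} ()
  absorb-free false {free} e = ≡.refl , ≡.refl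

  absorb-in : ∀ b {x} → absorb b x ≡ in! → x ≡ in!
  absorb-in true  {in!} e = ≡.refl
  absorb-in false {in!} e = ≡.refl

  absorb-agrees : ∀ b x m → (b ≡ true → m ≡ false) → Agrees x m → Agrees (absorb b x) m
  absorb-agrees true  in!  m h a = a
  absorb-agrees true  out! m h a = a
  absorb-agrees true  free m h a = h ≡.refl
  absorb-agrees false x    m h a = a

  agrees-absorb : ∀ b x m → Agrees (absorb b x) m → Agrees x m
  agrees-absorb true  in!  m a = a
  agrees-absorb true  out! m a = a
  agrees-absorb true  free m a = tt
  agrees-absorb false x    m a = a

  ─-free : ∀ s w i → (s ─ w) i ≡ free → i ≢ w × s i ≡ free
  ─-free s w i e with i ≟ w
  ... | no i≢w = i≢w , e

  ─-≢ : ∀ s w i → i ≢ w → (s ─ w) i ≡ s i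
  ─-≢ s w i i≢w with i ≟ w
  ... | yes i≡w = contradiction i≡w i≢w
  ... | no _    = ≡.refl

  ─-self : ∀ s w → (s ─ w) w ≡ out!
  ─-self s w with w ≟ w
  ... | yes _  = ≡.refl
  ... | no w≢w = contradiction ≡.refl w≢w

  ─-in : ∀ s w i → (s ─ w) i ≡ in! → s i ≡ in!
  ─-in s w i e with i ≟ w
  ... | no _ = e

  valid-─ : ∀ {s} w → Valid s → Valid (s ─ w)
  valid-─ {s} w val i j si sj = val i j (─-in s w i si) (proj₂ (─-free s w j sj))

  valid-✚ : ∀ {s} w → Valid s → Valid (s ✚ w)
  valid-✚ {s} w val i j si sj with i ≟ w | j ≟ w
  ... | yes ≡.refl | no _ = proj₁ (absorb-free (adj w j) sj)
  ... | no _       | no _ = val i j (absorb-in (adj w i) si) (proj₂ (absorb-free (adj w j) sj))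

  Fam-─⁺ : ∀ {s} w {σ} → Fam s σ → memb w σ ≡ false → Fam (s ─ w) σ
  Fam-─⁺ {s} w {σ} (ind , ag) mw = ind , agree
    where
    agree : ∀ i → Agrees ((s ─ w) i) (memb i σ)
    agree i with i ≟ w
    ... | yes ≡.refl = mw
    ... | no _       = ag i

  Fam-─⁻ : ∀ {s} w {σ} → s w ≡ free → Fam (s ─ w) σ → Fam s σ × memb w σ ≡ false
  Fam-─⁻ {s} w {σ} sw (ind , ag) =
    (ind , agree) , subst (λ x → Agrees x (memb w σ)) (─-self s w) (ag w)
    where
    agree : ∀ i → Agrees (s i) (memb i σ)
    agree i with i ≟ w | ag i
    ... | yes ≡.refl | _ = subst (λ x → Agrees x (memb w σ)) (≡.sym sw) tt
    ... | no _       | a = a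

  Fam-✚⁺ : ∀ {s} w {σ} → Fam s σ → memb w σ ≡ true → Fam (s ✚ w) σ
  Fam-✚⁺ {s} w {σ} (ind , ag) mw = ind , agree
    where
    agree : ∀ i → Agrees ((s ✚ w) i) (memb i σ)
    agree i with i ≟ w
    ... | yes ≡.refl = mw
    ... | no _       = absorb-agrees (adj w i) (s i) (memb i σ)
                         (λ aw → ¬-not λ mi → true≢false aw (ind w i mw mi)) (ag i)

  Fam-✚⁻ : ∀ {s} w {σ} → s w ≡ free → Fam (s ✚ w) σ → Fam s σ × memb w σ ≡ true
  Fam-✚⁻ {s} w {σ} sw (ind , ag) = (ind , agree) , member
    where
    agree : ∀ i → Agrees (s i) (memb i σ)
    agree i with i ≟ w | ag i
    ... | yes ≡.refl | _ = subst (λ x → Agrees x (memb w σ)) (≡.sym sw) tt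
    ... | no _       | a = agrees-absorb (adj w i) (s i) (memb i σ) a
    member : memb w σ ≡ true
    member with w ≟ w | ag w
    ... | yes _  | a = a
    ... | no w≢w | _ = contradiction ≡.refl w≢w

  #free : State → ℕ
  #free s = countFin (isFree ∘ s)

  degree : State → Fin N → ℕ
  degree s w = countFin (λ i → adj w i ∧ isFree (s i))

  ─-isFree : ∀ s w i → isFree ((s ─ w) i) ≡ true → isFree (s i) ≡ true
  ─-isFree s w i e with i ≟ w
  ... | no _ = e

  #free-─ : ∀ {s} w → s w ≡ free → #free (s ─ w) < #free s
  #free-─ {s} w sw = countFin-< w (cong isFree (─-self s w)) (cong isFree sw) (─-isFree s w)

  -- Choosing `w` decides its free neighbours, and strictness accounts for `w` itself.
  #free-✚ : ∀ {s} w → s w ≡ free → #free (s ✚ w) + degree s w < #free s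
  #free-✚ {s} w sw = ℕP.≤-<-trans (countFin-disjoint disjoint) (#free-─ w sw)
    where
    disjoint : ∀ i → toℕᵇ (isFree ((s ✚ w) i)) + toℕᵇ (adj w i ∧ isFree (s i)) ≤ toℕᵇ (isFree ((s ─ w) i))
    disjoint i with i ≟ w
    ... | yes ≡.refl rewrite adj-irrefl w = z≤n
    ... | no _ with adj w i | s i
    ... | true  | free = ℕP.≤-refl
    ... | true  | in!  = z≤n
    ... | true  | out! = z≤n
    ... | false | x    = ℕP.≤-reflexive (ℕP.+-identityʳ _)

  degree-─-< : ∀ {s} w {v} → s w ≡ free → adj v w ≡ true → degree (s ─ w) v < degree s v
  degree-─-< {s} w {v} sw avw = countFin-< w
    (≡.trans (cong (λ x → adj v w ∧ isFree x) (─-self s w)) (cong (_∧ false) avw))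
    (≡.trans (cong (λ x → adj v w ∧ isFree x) sw) (cong (_∧ true) avw))
    λ i e → let (a , f) = ∧-true⁻ {adj v i} e in cong₂ _∧_ a (─-isFree s w i f)

  degree-─-≥ : ∀ {s} w {x} → adj x w ≡ false → degree s x ≤ degree (s ─ w) x
  degree-─-≥ {s} w {x} axw = countFin-mono same
    where
    same : ∀ i → adj x i ∧ isFree (s i) ≡ true → adj x i ∧ isFree ((s ─ w) i) ≡ true
    same i e with i ≟ w
    ... | yes ≡.refl = contradiction axw (true≢false (proj₁ (∧-true⁻ {adj x i} e)))
    ... | no _       = e

  module _ {q : Level} {Q : (Subset N → Set) → ℕ → Set q} (rules : Rules Q) where
    open Rules rules

    -- The family of a node is in general no lower set, so its cost is measured by adding it to an
    -- arbitrary lower set disjoint from it. In this relative form the branches can be stacked on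
    -- one another.
    Extends : State → ℕ → Set (Level.suc Level.zero ⊔ q)
    Extends s k′ = ∀ {P P′ k} → Decidable P → Decidable P′ → Lower P → Lower P′ → P ⊆ P′ →
      (∀ σ → P′ σ → P σ ⊎ Fam s σ) → Fam s ⊆ P′ → (∀ σ → P σ → ¬ Fam s σ) → Q P k → Q P′ (k′ + k)

    extends-leaf : ∀ {s} → (∀ i → isFree (s i) ≡ false) → Extends s 1
    extends-leaf {s} none P? P′? lowP lowP′ P⊆P′ cover Fam⊆ disj =
      point P⊆P′ (tabulate (isIn ∘ s)) λ σ → [ inj₁ , inj₂ ∘ determined σ ]′ ∘ cover σ
      where
      value : ∀ x b → isFree x ≡ false → Agrees x b → b ≡ isIn x
      value in!  b e a = a
      value out! b e a = a
      determined : ∀ σ → Fam s σ → σ ≡ tabulate (isIn ∘ s)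
      determined σ (_ , ag) = ext-memb λ i → ≡.trans (value (s i) _ (none i) (ag i)) (≡.sym (memb-tabulate _ i))

    -- A neighbour of `v` is not free by assumption and not chosen by `Valid`, hence excluded; so
    -- toggling `v` preserves the family.
    extends-isolated : ∀ {s} → Valid s → ∀ v → s v ≡ free → (∀ w → adj v w ≡ true → s w ≢ free) → Extends s 0
    extends-isolated {s} val v sv iso {P} {P′} P? P′? lowP lowP′ P⊆P′ cover Fam⊆ disj =
      toggle P? P′? lowP lowP′ P⊆P′ v λ σ b (p′ , ¬p) → closed σ b ([ (λ p → contradiction p ¬p) , (λ f → f) ]′ (cover σ p′))
      where
      nbr-out : ∀ {σ} → Fam s σ → ∀ w → memb w σ ≡ true → adj v w ≡ false
      nbr-out {σ} (ind , ag) w mw with adj v w in avw | s w in sw | ag w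
      ... | false | _    | _ = ≡.refl
      ... | true  | free | _ = contradiction sw (iso w avw)
      ... | true  | in!  | _ = contradiction (val w v sw sv) (true≢false (≡.trans (adj-sym w v) avw))
      ... | true  | out! | a = contradiction a (true≢false mw)
      toggled : ∀ {σ} b → Fam s σ → Fam s (σ [ v ]≔ b)
      toggled {σ} b fam@(ind , ag) = ind′ , ag′
        where
        ind′ : Independent adj (σ [ v ]≔ b)
        ind′ i j mi mj with i ≟ v | j ≟ v
        ... | yes ≡.refl | yes ≡.refl = adj-irrefl v
        ... | yes ≡.refl | no j≢v = nbr-out fam j (≡.trans (≡.sym (memb-≔-≢ σ b j≢v)) mj)
        ... | no i≢v | yes ≡.refl = ≡.trans (adj-sym i v) (nbr-out fam i (≡.trans (≡.sym (memb-≔-≢ σ b i≢v)) mi))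
        ... | no i≢v | no j≢v = ind i j (≡.trans (≡.sym (memb-≔-≢ σ b i≢v)) mi) (≡.trans (≡.sym (memb-≔-≢ σ b j≢v)) mj)
        ag′ : ∀ i → Agrees (s i) (memb i (σ [ v ]≔ b))
        ag′ i with i ≟ v
        ... | yes ≡.refl = subst (λ x → Agrees x (memb v (σ [ v ]≔ b))) (≡.sym sv) tt
        ... | no i≢v     = subst (Agrees (s i)) (≡.sym (memb-≔-≢ σ b i≢v)) (ag i)
      closed : ∀ σ b → Fam s σ → Diff P′ P (σ [ v ]≔ b)
      closed σ b fam = Fam⊆ (toggled b fam) , λ p → disj _ p (toggled b fam)

    -- The sets avoiding `w` go in before those containing it: this order makes the intermediate
    -- family `P₁` a lower set.
    extends-split : ∀ {s k₁ k₂} w → s w ≡ free → Extends (s ✚ w) k₁ → Extends (s ─ w) k₂ → Extends s (k₁ + k₂)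
    extends-split {s} {k₁} {k₂} w sw ext₁ ext₂ {P} {P′} {k} P? P′? lowP lowP′ P⊆P′ cover Fam⊆ disj QP =
      subst (Q P′) (≡.sym (ℕP.+-assoc k₁ k₂ k))
        (ext₁ P₁? P′? lowP₁ lowP′ [ P⊆P′ , Fam⊆ ∘ proj₁ ∘ Fam-─⁻ w sw ]′ cover₁ (Fam⊆ ∘ proj₁ ∘ Fam-✚⁻ w sw) disj₁
          (ext₂ P? P₁? lowP lowP₁ inj₁ (λ _ p → p) inj₂ (λ σ p f → disj σ p (proj₁ (Fam-─⁻ w sw f))) QP))
      where
      P₁ : Subset N → Set
      P₁ σ = P σ ⊎ Fam (s ─ w) σ
      P₁? : Decidable P₁
      P₁? σ = P? σ ⊎-dec Fam? (s ─ w) σ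
      lowP₁ : Lower P₁
      lowP₁ σ⊑τ (inj₁ p) = inj₁ (lowP σ⊑τ p)
      lowP₁ {σ} {τ} σ⊑τ (inj₂ f) with Fam-─⁻ w sw f
      ... | fam , mw with cover σ (lowP′ σ⊑τ (Fam⊆ fam))
      ... | inj₁ p    = inj₁ p
      ... | inj₂ fam′ = inj₂ (Fam-─⁺ w fam′ (¬-not λ m → true≢false (σ⊑τ w m) mw))
      cover₁ : ∀ σ → P′ σ → P₁ σ ⊎ Fam (s ✚ w) σ
      cover₁ σ p′ with cover σ p′ | memb w σ in mw
      ... | inj₁ p | _     = inj₁ (inj₁ p)
      ... | inj₂ f | true  = inj₂ (Fam-✚⁺ w f mw)
      ... | inj₂ f | false = inj₁ (inj₂ (Fam-─⁺ w f mw))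
      disj₁ : ∀ σ → P₁ σ → ¬ Fam (s ✚ w) σ
      disj₁ σ (inj₁ p) f = disj σ p (proj₁ (Fam-✚⁻ w sw f))
      disj₁ σ (inj₂ g) f = true≢false (proj₂ (Fam-✚⁻ w sw f)) (proj₂ (Fam-─⁻ w sw g))

    module _ (r : ℚ.ℚ) (above : AboveΓ r) where
      open Numbers r above

      Solved : State → Set (Level.suc Level.zero ⊔ q)
      Solved s = ∃ λ k → fromℕ k ℚ.≤ powℚ r (#free s) × Extends s k

      -- `d` remains the minimum degree found at the outset, whereas `l` bounds the neighbours of
      -- `v` that are still free and drops as each is excluded. The solution of smaller states
      -- enters as an argument, which keeps the recursion on the number of free vertices structural.
      neighbours : ∀ {f} → (∀ s → Valid s → #free s ≤ f → Solved s) → ∀ v d l s → Valid s → s v ≡ free →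
        degree s v ≤ l → (∀ w → adj v w ≡ true → s w ≡ free → d ≤ degree s w) → #free s ≤ suc f →
        ∃ λ k → Partial d l (#free s) k × Extends s k
      neighbours resolve v d l s val sv deg large fuel
        with any? (λ w → (adj v w ∧ isFree (s w)) ≟ᵇ true)
      ... | no none = 0 , partial-zero d l (#free s) ,
              extends-isolated val v sv λ w avw sw → none (w , cong₂ _∧_ avw (cong isFree sw))
      neighbours resolve v d zero s val sv deg large fuel | yes (w , e)
        with () ← ℕP.<-≤-trans (degree-─-< w (isFree⇒ (proj₂ (∧-true⁻ {adj v w} e))) (proj₁ (∧-true⁻ {adj v w} e))) deg
      neighbours resolve v d (suc l) s val sv deg large fuel | yes (w , e)
        with avw , fw ← ∧-true⁻ {adj v w} e
        with sw ← isFree⇒ fw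
        with k₁ , small , ext₁ ← resolve (s ✚ w) (valid-✚ w val)
                                   (s≤s⁻¹ (ℕP.<-≤-trans (ℕP.≤-<-trans (ℕP.m≤m+n _ _) (#free-✚ w sw)) fuel))
        with k₂ , part , ext₂ ← neighbours resolve v d l (s ─ w) (valid-─ w val)
               (≡.trans (─-≢ s w v λ { ≡.refl → true≢false avw (adj-irrefl v) }) sv)
               (s≤s⁻¹ (ℕP.<-≤-trans (degree-─-< w sw avw) deg))
               -- Another neighbour x of `v` is not adjacent to `w`, since there are no triangles;
               -- so excluding `w` does not lower its degree.
               (λ x avx sx → ℕP.≤-trans (large x avx (proj₂ (─-free s w x sx)))
                                     (degree-─-≥ w (triangle-free v x w avx avw)))
               (ℕP.<⇒≤ (ℕP.<-≤-trans (#free-─ w sw) fuel))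
        = k₁ + k₂
        , partial-step d l (#free s) (#free (s ✚ w)) (#free (s ─ w)) k₁ k₂ small
            (ℕP.≤-<-trans (ℕP.+-monoʳ-≤ (#free (s ✚ w)) (large w avw sw)) (#free-✚ w sw)) part (#free-─ w sw)
        , extends-split w sw ext₁ ext₂

      resolve : ∀ f s → Valid s → #free s ≤ f → Solved s
      resolve f s val fuel with argmin (isFree ∘ s) (degree s)
      ... | inj₁ none = 1 , 1≤pow (#free s) , extends-leaf none
      resolve zero s val fuel | inj₂ (v , fv , _) with () ← ℕP.<-≤-trans (#free-─ v (isFree⇒ fv)) fuel
      resolve (suc f) s val fuel | inj₂ (v , fv , min)
        with k , part , ext ← neighbours (resolve f) v (degree s v) (degree s v) s val (isFree⇒ fv) ℕP.≤-refl
                                (λ w _ sw → min w (cong isFree sw)) fuel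
        = k , partial-final (degree s v) (#free s) k part , ext

      independent-bound : ∃ λ k → fromℕ k ℚ.≤ powℚ r N × Q (Independent adj) k
      independent-bound with resolve N (λ _ → free) (λ _ _ ()) (ℕP.≤-reflexive (countFin-true N))
      ... | k , small , ext = k , subst (λ u → fromℕ k ℚ.≤ powℚ r u) (countFin-true N) small ,
        subst (Q (Independent adj)) (ℕP.+-identityʳ k)
          -- The filtration starts at the void complex, and the root state has all independent sets
          -- as its family.
          (ext (λ _ → no λ ()) (independent? adj) (λ _ ()) (independent-lower adj) (λ ())
               (λ σ ind → inj₂ (ind , λ _ → tt)) proj₁ (λ _ ()) base)

-- Bipartite graphs

memb-++ˡ : ∀ {n m} x (σ : Subset n) (ρ : Subset m) → memb (x ↑ˡ m) (σ ++ ρ) ≡ memb x σ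
memb-++ˡ zero    (b ∷ σ) ρ = ≡.refl
memb-++ˡ (suc x) (b ∷ σ) ρ = memb-++ˡ x σ ρ

memb-++ʳ : ∀ {n m} y (σ : Subset n) (ρ : Subset m) → memb (n ↑ʳ y) (σ ++ ρ) ≡ memb y ρ
memb-++ʳ y []      ρ = ≡.refl
memb-++ʳ y (b ∷ σ) ρ = memb-++ʳ y σ ρ

Const : ∀ {n} → Bool → Subset n → Set
Const b σ = ∀ i → memb i σ ≡ b

const? : ∀ {n} b → Decidable (Const {n} b)
const? b σ = all? λ i → memb i σ ≟ᵇ b

const-replicate : ∀ n b → Const {n} b (replicate n b)
const-replicate (suc n) b zero    = ≡.refl
const-replicate (suc n) b (suc i) = const-replicate n b i

const⇒≡ : ∀ {n b} {σ : Subset n} → Const b σ → σ ≡ replicate n b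
const⇒≡ {n} {b} c = ext-memb λ i → ≡.trans (c i) (≡.sym (const-replicate n b i))

¬const : ∀ {n b} {σ : Subset n} → ¬ Const b σ → ∃ λ i → memb i σ ≡ not b
¬const {n} {b} {σ} ¬c with any? (λ i → memb i σ ≟ᵇ not b)
... | yes e = e
... | no ¬e = contradiction (λ i → decidable-stable (memb i σ ≟ᵇ b) λ ≢b → ¬e (i , ¬-not ≢b)) ¬c

module Bipartite {n m : ℕ} (e : Fin n → Fin m → Bool) where

  adj⊎ : Fin n ⊎ Fin m → Fin n ⊎ Fin m → Bool
  adj⊎ (inj₁ x) (inj₂ y) = e x y
  adj⊎ (inj₂ y) (inj₁ x) = e x y
  adj⊎ _        _        = false

  edge : Fin (n + m) → Fin (n + m) → Bool
  edge i j = adj⊎ (splitAt n i) (splitAt n j)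

  edge-sym : ∀ i j → edge i j ≡ edge j i
  edge-sym i j with splitAt n i | splitAt n j
  ... | inj₁ _ | inj₁ _ = ≡.refl
  ... | inj₁ _ | inj₂ _ = ≡.refl
  ... | inj₂ _ | inj₁ _ = ≡.refl
  ... | inj₂ _ | inj₂ _ = ≡.refl

  edge-irrefl : ∀ i → edge i i ≡ false
  edge-irrefl i with splitAt n i
  ... | inj₁ _ = ≡.refl
  ... | inj₂ _ = ≡.refl

  edge-triangle-free : ∀ v i j → edge v i ≡ true → edge v j ≡ true → edge i j ≡ false
  edge-triangle-free v i j vi vj with splitAt n v | splitAt n i | splitAt n j
  ... | inj₁ _ | inj₂ _ | inj₂ _ = ≡.refl
  ... | inj₂ _ | inj₁ _ | inj₁ _ = ≡.refl

  Indep : Subset (n + m) → Set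
  Indep = Independent edge

  Avoids : Subset (n + m) → Fin m → Set
  Avoids τ w = ∀ x → memb (x ↑ˡ m) τ ≡ true → e x w ≡ false

  avoids? : ∀ τ → Decidable (Avoids τ)
  avoids? τ w = all? λ x → (memb (x ↑ˡ m) τ ≟ᵇ true) →-dec (e x w ≟ᵇ false)

  -- The union of the stars of the first j right vertices. For j = m it holds every independent set
  -- that contains a right vertex; a set of left vertices lies in it when some right vertex has no
  -- neighbour in the set.
  Cone : ℕ → Subset (n + m) → Set
  Cone j τ = Indep τ × ∃ λ w → toℕ w < j × Avoids τ w

  cone? : ∀ j → Decidable (Cone j)
  cone? j τ = independent? edge τ ×-dec any? λ w → (toℕ w ℕ.<? j) ×-dec avoids? τ w

  cone-lower : ∀ j → Lower (Cone j)
  cone-lower j σ⊑τ (ind , w , w<j , av) =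
    independent-lower edge σ⊑τ ind , w , w<j , λ x mx → av x (σ⊑τ (x ↑ˡ m) mx)

  edge-avoids : ∀ {τ w} → Avoids τ w → ∀ j → memb j τ ≡ true → edge (n ↑ʳ w) j ≡ false
  edge-avoids {τ} {w} av j mj rewrite splitAt-↑ʳ n m w with splitAt n j in eq
  ... | inj₁ x = av x (≡.trans (cong (λ i → memb i τ) (splitAt⁻¹-↑ˡ eq)) mj)
  ... | inj₂ y = ≡.refl

  ↑ˡ≢↑ʳ : ∀ {x : Fin n} {y : Fin m} → x ↑ˡ m ≢ n ↑ʳ y
  ↑ˡ≢↑ʳ {x} {y} eq with () ← ≡.trans (≡.sym (splitAt-↑ˡ n x m)) (≡.trans (cong (splitAt n) eq) (splitAt-↑ʳ n m y))

  avoids-toggle : ∀ {τ y b w} → Avoids τ w → Avoids (τ [ n ↑ʳ y ]≔ b) w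
  avoids-toggle {τ} {y} {b} av x mx = av x (≡.trans (≡.sym (memb-≔-≢ τ b (↑ˡ≢↑ʳ {x} {y}))) mx)

  avoids-untoggle : ∀ {τ y b w} → Avoids (τ [ n ↑ʳ y ]≔ b) w → Avoids τ w
  avoids-untoggle {τ} {y} {b} av x mx = av x (≡.trans (memb-≔-≢ τ b (↑ˡ≢↑ʳ {x} {y})) mx)

  indep-toggle : ∀ {τ w} b → Indep τ → Avoids τ w → Indep (τ [ n ↑ʳ w ]≔ b)
  indep-toggle {τ} {w} b ind av i j mi mj with i ≟ (n ↑ʳ w) | j ≟ (n ↑ʳ w)
  ... | yes ≡.refl | _          = edge-avoids (avoids-toggle {τ} {w} {b} av) j mj
  ... | no i≢      | yes ≡.refl = ≡.trans (edge-sym i j) (edge-avoids (avoids-toggle {τ} {w} {b} av) i mi)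
  ... | no i≢      | no j≢      = ind i j (≡.trans (≡.sym (memb-≔-≢ τ b i≢)) mi) (≡.trans (≡.sym (memb-≔-≢ τ b j≢)) mj)

  indep-left : ∀ {τ} → (∀ y → memb (n ↑ʳ y) τ ≡ false) → Indep τ
  indep-left {τ} none i j mi mj with splitAt n i in ei | splitAt n j in ej
  ... | inj₁ _ | inj₁ _ = ≡.refl
  ... | inj₂ _ | inj₂ _ = ≡.refl
  ... | inj₁ _ | inj₂ y = contradiction (none y) (true≢false (≡.trans (cong (λ k → memb k τ) (splitAt⁻¹-↑ʳ ej)) mj))
  ... | inj₂ y | inj₁ _ = contradiction (none y) (true≢false (≡.trans (cong (λ k → memb k τ) (splitAt⁻¹-↑ʳ ei)) mi))

  indep⇒avoids : ∀ {τ y} → Indep τ → memb (n ↑ʳ y) τ ≡ true → Avoids τ y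
  indep⇒avoids {τ} {y} ind my x mx =
    ≡.trans (cong₂ adj⊎ (≡.sym (splitAt-↑ˡ n x m)) (≡.sym (splitAt-↑ʳ n m y))) (ind _ _ mx my)

  module _ {q : Level} {Q : (Subset (n + m) → Set) → ℕ → Set q} (rules : Rules Q) where
    open Rules rules

    -- The sets for which y is the first right vertex with no neighbour in the set can be toggled at y.
    cone-bound : ∀ j → j ≤ m → Q (Cone j) 0
    cone-bound zero    _   = resp (λ ()) (λ ()) base
    cone-bound (suc j) j<m = toggle (cone? j) (cone? (suc j)) (cone-lower j) (cone-lower (suc j))
      (λ (ind , w , w<j , av) → ind , w , ℕP.m<n⇒m<1+n w<j , av) (n ↑ʳ w₀) closed (cone-bound j (ℕP.<⇒≤ j<m))
      where
      w₀ = fromℕ< j<m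
      closed : ToggleClosed (n ↑ʳ w₀) (Diff (Cone (suc j)) (Cone j))
      closed τ b ((ind , w , w<1+j , av) , ¬c) with toℕ w ℕ.<? j
      ... | yes w<j = contradiction (ind , w , w<j , av) ¬c
      ... | no  w≮j with ≡.refl ← toℕ-injective {i = w} {w₀}
                          (≡.trans (ℕP.≤-antisym (s≤s⁻¹ w<1+j) (ℕP.≮⇒≥ w≮j)) (≡.sym (toℕ-fromℕ< j<m)))
        = (indep-toggle b ind av , w , w<1+j , avoids-toggle {τ} {w} {b} av)
        , λ (ind′ , w′ , w′<j , av′) → ¬c (ind , w′ , w′<j , avoids-untoggle {τ} {w} {b} av′)

-- From the bipartite graph back to the complex

module Transfer {c ℓ : Level} (F : Field c ℓ) where
  open Homology F
  open Linear F
  open Bounds F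
  open Field F
    using (_≈_; 0#; refl; sym; trans; setoid; reflexive; +-congˡ; +-congʳ; -‿cong; +-identityˡ)
    renaming (_+_ to _⊕_; -_ to ⊖_)
  open Relation.Binary.Reasoning.Setoid setoid

  bound-resp : ∀ {n k} {P P′ : Subset n → Set} → P ⊆ P′ → P′ ⊆ P → Bound P k → Bound P′ k
  bound-resp P⊆P′ P′⊆P (φ , h , bd) = φ , h , λ z s ∂z φz →
    let (s′ , ∂h) = bd z (Supp-⊆ P′⊆P s) ∂z φz in Supp-⊆ P⊆P′ s′ , ∂h

  rules-up : ∀ {n} → Rules {N = n} Bound
  rules-up = record
    { base   = bound-∅
    ; resp   = bound-resp
    ; toggle = λ P? P′? low low′ P⊆P′ v tc → Toggle.up P? P′? low low′ P⊆P′ v tc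
    ; point  = λ P⊆P′ p P′⊆ → Point.up P⊆P′ p P′⊆ }

  -- The combinatorial Alexander dual.
  Co : ∀ {n} → (Subset n → Set) → Subset n → Set
  Co P τ = ¬ P (∁ τ)

  co? : ∀ {n} {P : Subset n → Set} → Decidable P → Decidable (Co P)
  co? P? τ = ¬? (P? (∁ τ))

  co-lower : ∀ {n} {P : Subset n → Set} → Lower P → Lower (Co P)
  co-lower low σ⊑τ ¬p p = ¬p (low (∁-⊑ σ⊑τ) p)

  -- Complementation turns a filtration by lower sets upside down.
  rules-down : ∀ {n} → Rules {N = suc n} (λ P → Bound (Co P))
  rules-down = record
    { base   = bound-full λ _ p → p
    ; resp   = λ P⊆P′ P′⊆P → bound-resp (λ ¬p p → ¬p (P′⊆P p)) (λ ¬p p → ¬p (P⊆P′ p))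
    ; toggle = λ {P} {P′} P? P′? low low′ P⊆P′ v tc →
        Toggle.down (co? P′?) (co? P?) (co-lower low′) (co-lower low) (λ ¬p p → ¬p (P⊆P′ p)) v
          λ τ b (¬p , ¬¬p′) →
            let (p′ , ¬p₁) = tc (∁ τ) (not b) (decidable-stable (P′? (∁ τ)) ¬¬p′ , ¬p)
                eq = ≡.sym (∁-≔ τ v b)
            in (λ p → ¬p₁ (subst P (≡.sym eq) p)) , λ ¬p″ → ¬p″ (subst P′ eq p′)
    ; point  = λ {P} {P′} P⊆P′ p P′⊆ → Point.down (λ ¬p q → ¬p (P⊆P′ q)) (∁ p) λ τ ¬P → decide P′⊆ τ ¬P (≡-dec _≟ᵇ_ (∁ τ) p) }
    where
    decide : ∀ {n} {P P′ : Subset n → Set} {p} → (∀ σ → P′ σ → P σ ⊎ σ ≡ p) → ∀ τ → Co P τ →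
             Dec (∁ τ ≡ p) → Co P′ τ ⊎ τ ≡ ∁ p
    decide P′⊆ τ ¬P (yes eq) = inj₂ (≡.trans (≡.sym (∁-involutive τ)) (cong ∁ eq))
    decide P′⊆ τ ¬P (no ≢p)  = inj₁ ([ ¬P , ≢p ]′ ∘ P′⊆ (∁ τ))

  module _ {m : ℕ} {G : Subset m → Set} (G? : Decidable G) where

    -- Copies a chain on the left vertices to every right part satisfying `G`. It is applied with
    -- the empty right part, as the inclusion of the left simplex, and with the full one.
    extend : ∀ n → Lin (Subset n) (Subset (n + m))
    extend zero    = keep G? ∘ₗ reindex (λ _ → [])
    extend (suc n) = fork (extend n ∘ₗ slice false) (extend n ∘ₗ slice true)

    extend-on : ∀ {n} z (σ : Subset n) {ρ} → G ρ → ap (extend n) z (σ ++ ρ) ≈ z σ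
    extend-on z []          g = keep-in G? _ g
    extend-on z (false ∷ σ) g = extend-on _ σ g
    extend-on z (true ∷ σ)  g = extend-on _ σ g

    extend-off : ∀ {n} z (σ : Subset n) {ρ} → ¬ G ρ → ap (extend n) z (σ ++ ρ) ≈ 0#
    extend-off z []          ¬g = keep-out G? _ ¬g
    extend-off z (false ∷ σ) ¬g = extend-off _ σ ¬g
    extend-off z (true ∷ σ)  ¬g = extend-off _ σ ¬g

    -- The hypothesis leaves only the empty right part, from which no right vertex can be removed.
    -- Left vertices come first in the order, so their signs are unaffected.
    ∂-extend : (∀ ρ v → ¬ G (ρ [ v ]≔ true)) → ∀ n z τ →
               ap (∂ₗ (n + m)) (ap (extend n) z) τ ≈ ap (extend n) (ap (∂ₗ n) z) τ
    ∂-extend ¬G zero z ρ = trans (∂-local m _ ρ λ v _ → keep-out G? _ (¬G ρ v)) (sym (ap-0 (keep G?) (λ _ → refl) ρ))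
    ∂-extend ¬G (suc n) z (false ∷ τ) = trans (+-congˡ (∂-extend ¬G n _ τ)) (sym (ap-⊕ (extend n) _ _ τ))
    ∂-extend ¬G (suc n) z (true ∷ τ)  = trans (-‿cong (∂-extend ¬G n _ τ)) (sym (ap-⊖ (extend n) _ τ))

  at : ∀ {n m} → Subset m → Lin (Subset (n + m)) (Subset n)
  at ρ = reindex (_++ ρ)

  -- No vertex can be added to a full right part, so over it the boundary collects contributions of
  -- left vertices alone.
  ∂-at : ∀ {m} {ρ : Subset m} → Const true ρ → ∀ n x σ →
         ap (∂ₗ n) (ap (at {n} ρ) x) σ ≈ ap (∂ₗ (n + m)) x (σ ++ ρ)
  ∂-at {m} {ρ} full zero x [] = sym (∂-local m x ρ λ v mv → contradiction mv (true≢false (full v)))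
  ∂-at full (suc n) x (false ∷ σ) = +-congˡ (∂-at full n _ σ)
  ∂-at full (suc n) x (true ∷ σ)  = -‿cong (∂-at full n _ σ)

  by-parts : ∀ {a} n {m} {A : Subset (n + m) → Set a} → (∀ σ ρ → A (σ ++ ρ)) → ∀ τ → A τ
  by-parts n {A = A} f τ = subst A (take++drop≡id n τ) (f (take n τ) (drop n τ))

  -- Without vertices there is no apex to cone at. The only coefficient is that of the empty set.
  bound-point : ∀ {P : Subset 0 → Set} → Bound P 1
  bound-point = record
      { ap = λ z _ → z [] ; ap-cong = λ e _ → e [] ; ap-⊕ = λ _ _ _ → refl ; ap-⊗ = λ _ _ _ → refl }
    , zeroₗ , λ z s ∂z φz → (λ _ _ → refl) , λ { [] → sym (φz zero) }

  module _ {n m : ℕ} (e : Fin (suc n) → Fin m → Bool) (K : Subset (suc n) → Set) where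
    open Bipartite e

    private
      X = suc n
      D = ∂ₗ (X + m)

    -- H(K) is computed from the two contractible subcomplexes Cone m and the full simplex on the left
    -- vertices, which cover the independence complex and meet in K.
    bound-cover : (∀ σ → K σ → ∃ λ w → ∀ x → memb x σ ≡ true → e x w ≡ false) →
                  (∀ σ w → (∀ x → memb x σ ≡ true → e x w ≡ false) → K σ) →
                  ∀ {k} → Bound (Cone m) 0 → Bound Indep k → Bound K k
    bound-cover K⇒ ⇒K {k} (_ , hA , bdA) (φ , h , bd) = φ ∘ₗ yₗ , hₗ , bounds
      where
      ∅ : Subset m
      ∅ = replicate m false
      ∅-empty : Const false ∅
      ∅-empty = const-replicate m false
      ι : Lin (Subset X) (Subset (X + m))
      ι = extend (const? false) X
      yₗ dₗ : Lin (Subset X) (Subset (X + m))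
      -- As in Mayer-Vietoris: z bounds in the left simplex by coning at `zero` and in `Cone m`
      -- through `hA`; the difference of the two chains is a cycle of the independence complex.
      yₗ = ι ∘ₗ wedge zero ∸ₗ hA ∘ₗ ι
      dₗ = keep (¬? ∘ cone? m) ∘ₗ h ∘ₗ yₗ
      hₗ : Lin (Subset X) (Subset X)
      -- If that cycle bounds a chain s, the part d of s outside `Cone m` lies in the left simplex.
      -- Subtracting ∂d from the cone over z removes everything outside `K` and does not change the
      -- boundary.
      hₗ = wedge zero ∸ₗ ∂ₗ X ∘ₗ at ∅ ∘ₗ dₗ

      ∂ι : ∀ z τ → ap D (ap ι z) τ ≈ ap ι (ap (∂ₗ X) z) τ
      ∂ι = ∂-extend (const? false) (λ ρ v g → true≢false (memb-≔ ρ v true) (g v)) X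

      empty-indep : ∀ σ {ρ} → Const false ρ → Indep (σ ++ ρ)
      empty-indep σ {ρ} em = indep-left λ y → ≡.trans (memb-++ʳ y σ ρ) (em y)

      bounds : ∀ z → Supp K z → (∀ σ → ap (∂ₗ X) z σ ≈ 0#) → (∀ i → ap φ (ap yₗ z) i ≈ 0#) →
               Supp K (ap hₗ z) × (∀ σ → ap (∂ₗ X) (ap hₗ z) σ ≈ z σ)
      bounds z sz ∂z φy = supp , bdry
        where
        u = ap (wedge zero) z
        t = ap hA (ap ι z)
        y = ap yₗ z
        s = ap h y
        d = ap dₗ z
        ∂u : ∀ σ → ap (∂ₗ X) u σ ≈ z σ
        ∂u = wedge-∂ zero z ∂z

        ιz-supp : Supp (Cone m) (ap ι z)
        ιz-supp = by-parts X λ σ ρ ¬c → case σ ρ ¬c (const? false ρ)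
          where
          case : ∀ σ ρ → ¬ Cone m (σ ++ ρ) → Dec (Const false ρ) → ap ι z (σ ++ ρ) ≈ 0#
          case σ ρ ¬c (no ¬em) = extend-off (const? false) z σ ¬em
          case σ ρ ¬c (yes em) = trans (extend-on (const? false) z σ em) (sz σ λ kσ →
            let (w , av) = K⇒ σ kσ
            in ¬c (empty-indep σ em , w , toℕ<n w , λ x mx → av x (≡.trans (≡.sym (memb-++ˡ x σ ρ)) mx)))

        A = bdA (ap ι z) ιz-supp (λ τ → trans (∂ι z τ) (ap-0 ι ∂z τ)) (λ ())

        y-supp : Supp Indep y
        y-supp τ ¬ind = ∸-zero (ιu-zero τ ¬ind) (Supp-⊆ proj₁ (proj₁ A) τ ¬ind)
          where
          ιu-zero : Supp Indep (ap ι u)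
          ιu-zero = by-parts X λ σ ρ ¬i → extend-off (const? false) u σ (¬i ∘ empty-indep σ)

        ∂y : ∀ τ → ap D y τ ≈ 0#
        ∂y τ = trans (ap-∸ D (ap ι u) t τ) (x≈y⇒x∸y≈0
          (trans (∂ι u τ) (trans (ap-cong ι ∂u τ) (sym (proj₂ A τ)))))

        S = bd y y-supp ∂y φy

        ιπd : ∀ τ → ap ι (ap (at ∅) d) τ ≈ d τ
        ιπd = by-parts X λ σ ρ → case σ ρ (const? false ρ)
          where
          case : ∀ σ ρ → Dec (Const false ρ) → ap ι (ap (at ∅) d) (σ ++ ρ) ≈ d (σ ++ ρ)
          case σ ρ (yes em) = trans (extend-on (const? false) _ σ em)
                                    (reflexive (cong (λ ρ → d (σ ++ ρ)) (≡.sym (const⇒≡ em))))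
          case σ ρ (no ¬em) = trans (extend-off (const? false) _ σ ¬em) (sym (zero-d (cone? m (σ ++ ρ))))
            where
            zero-d : Dec (Cone m (σ ++ ρ)) → d (σ ++ ρ) ≈ 0#
            zero-d (yes c) = keep-out (¬? ∘ cone? m) s (λ ¬c → ¬c c)
            zero-d (no ¬c) = trans (keep-in (¬? ∘ cone? m) s ¬c) (proj₁ S _ λ ind →
              let (v , mv) = ¬const ¬em
              in ¬c (ind , v , toℕ<n v , indep⇒avoids ind (≡.trans (memb-++ʳ v σ ρ) mv)))

        bdry : ∀ σ → ap (∂ₗ X) (ap hₗ z) σ ≈ z σ
        bdry σ = trans (ap-∸ (∂ₗ X) _ _ σ) (trans (∸-zeroʳ (∂∂≈0 X _ σ)) (∂u σ))

        supp : Supp K (ap hₗ z)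
        supp σ ¬k = x≈y⇒x∸y≈0 (begin
          u σ                                          ≈⟨ sym (extend-on (const? false) u σ ∅-empty) ⟩
          ap ι u τ                                     ≈⟨ sym (∸-zeroʳ (proj₁ A τ ¬c)) ⟩
          y τ                                          ≈⟨ sym (proj₂ S τ) ⟩
          ap D s τ                                     ≈⟨ sym (ap-cong D (keep-split (cone? m) s) τ) ⟩
          ap D (λ τ → ap (keep (cone? m)) s τ ⊕ d τ) τ ≈⟨ ap-⊕ D _ _ τ ⟩
          ap D (ap (keep (cone? m)) s) τ ⊕ ap D d τ
            ≈⟨ +-congʳ (Supp-∂ (cone-lower m) (λ _ → keep-out (cone? m) s) τ ¬c) ⟩
          0# ⊕ ap D d τ                                ≈⟨ +-identityˡ _ ⟩
          ap D d τ                                     ≈⟨ sym (ap-cong D ιπd τ) ⟩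
          ap D (ap ι (ap (at ∅) d)) τ                  ≈⟨ ∂ι _ τ ⟩
          ap ι (ap (∂ₗ X) (ap (at ∅) d)) τ             ≈⟨ extend-on (const? false) _ σ ∅-empty ⟩
          ap (∂ₗ X) (ap (at ∅) d) σ                    ∎)
          where
          τ = σ ++ ∅
          ¬c : ¬ Cone m τ
          ¬c (_ , w , _ , av) = ¬k (⇒K σ w λ x mx → av x (≡.trans (memb-++ˡ x σ ∅) mx))

    -- The Alexander dual situation: K, placed at the full right side, is the difference of Co (Cone m),
    -- which is acyclic, and Co Indep.
    bound-transversal : (∀ σ → K σ → ∀ w → ¬ (∀ x → memb x σ ≡ false → e x w ≡ false)) →
                        (∀ σ → (∀ w → ¬ (∀ x → memb x σ ≡ false → e x w ≡ false)) → K σ) →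
                        ∀ {k} → Bound (Co (Cone m)) 0 → Bound (Co Indep) k → Bound K k
    bound-transversal K⇒ ⇒K {k} (_ , hM , bdM) (φ , hN , bdN) = φ ∘ₗ D ∘ₗ κ , at Y ∘ₗ hM ∘ₗ xₗ , bounds
      where
      Y : Subset m
      Y = replicate m true
      Y-full : Const true Y
      Y-full = const-replicate m true
      κ xₗ : Lin (Subset X) (Subset (X + m))
      κ = extend (const? true) X
      -- A connecting homomorphism: the boundary of the placed chain is a cycle in `Co Indep`. If it
      -- bounds there, the correction by `hN` gives a cycle of the acyclic `Co (Cone m)`. The
      -- correction vanishes over the full right part, so a bounding chain read off there bounds z.
      xₗ = κ ∸ₗ hN ∘ₗ D ∘ₗ κ

      memb-∁ˡ : ∀ x (σ : Subset X) (ρ : Subset m) → memb (x ↑ˡ m) (∁ (σ ++ ρ)) ≡ not (memb x σ)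
      memb-∁ˡ x σ ρ = ≡.trans (memb-∁ (x ↑ˡ m) (σ ++ ρ)) (cong not (memb-++ˡ x σ ρ))

      memb-∁ʳ : ∀ y (σ : Subset X) (ρ : Subset m) → memb (X ↑ʳ y) (∁ (σ ++ ρ)) ≡ not (memb y ρ)
      memb-∁ʳ y σ ρ = ≡.trans (memb-∁ (X ↑ʳ y) (σ ++ ρ)) (cong not (memb-++ʳ y σ ρ))

      full-indep : ∀ σ {ρ} → Const true ρ → Indep (∁ (σ ++ ρ))
      full-indep σ {ρ} fu = indep-left λ y → ≡.trans (memb-∁ʳ y σ ρ) (cong not (fu y))

      K⇒Co : ∀ σ ρ → K σ → Co (Cone m) (σ ++ ρ)
      K⇒Co σ ρ kσ (_ , w , _ , av) = K⇒ σ kσ w λ x mx → av x (≡.trans (memb-∁ˡ x σ ρ) (cong not mx))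

      Co⇒K : ∀ σ → Co (Cone m) (σ ++ Y) → K σ
      Co⇒K σ co = ⇒K σ λ w av → co (full-indep σ Y-full , w , toℕ<n w , λ x mx →
        av x (¬-not λ mσ → true≢false mx (≡.trans (memb-∁ˡ x σ Y) (cong not mσ))))

      bounds : ∀ z → Supp K z → (∀ σ → ap (∂ₗ X) z σ ≈ 0#) → (∀ i → ap φ (ap D (ap κ z)) i ≈ 0#) →
               Supp K (ap (at Y) (ap hM (ap xₗ z))) × (∀ σ → ap (∂ₗ X) (ap (at Y) (ap hM (ap xₗ z))) σ ≈ z σ)
      bounds z sz ∂z φz = (λ σ ¬k → proj₁ M (σ ++ Y) (¬k ∘ Co⇒K σ)) , bdry
        where
        z′ = ap κ z
        u = ap hN (ap D z′)
        x = ap xₗ z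

        z′-supp : Supp (Co (Cone m)) z′
        z′-supp = by-parts X λ σ ρ ¬co → case σ ρ ¬co (const? true ρ)
          where
          case : ∀ σ ρ → ¬ Co (Cone m) (σ ++ ρ) → Dec (Const true ρ) → z′ (σ ++ ρ) ≈ 0#
          case σ ρ ¬co (no ¬fu) = extend-off (const? true) z σ ¬fu
          case σ ρ ¬co (yes fu) = trans (extend-on (const? true) z σ fu) (sz σ (¬co ∘ K⇒Co σ ρ))

        ∂z′-supp : Supp (Co Indep) (ap D z′)
        ∂z′-supp = by-parts X λ σ ρ ¬co → case σ ρ (decidable-stable (independent? edge _) ¬co) (const? true ρ)
          where
          case : ∀ σ ρ → Indep (∁ (σ ++ ρ)) → Dec (Const true ρ) → ap D z′ (σ ++ ρ) ≈ 0#
          case σ ρ ind (yes fu) = trans (sym (∂-at fu X z′ σ))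
            (trans (ap-cong (∂ₗ X) (λ σ → extend-on (const? true) z σ fu) σ) (∂z σ))
          case σ ρ ind (no ¬fu) = Supp-∂ (co-lower (cone-lower m)) z′-supp (σ ++ ρ) λ co →
            let (v , mv) = ¬const ¬fu
            in co (ind , v , toℕ<n v , indep⇒avoids ind (≡.trans (memb-∁ʳ v σ ρ) (cong not mv)))

        U = bdN (ap D z′) ∂z′-supp (∂∂≈0 (X + m) z′) φz

        M = bdM x
          (λ τ ¬co → ∸-zero (z′-supp τ ¬co) (proj₁ U τ λ ¬i → ¬co λ c → ¬i (proj₁ c)))
          (λ τ → trans (ap-∸ D z′ u τ) (x≈y⇒x∸y≈0 (sym (proj₂ U τ))))
          (λ ())

        bdry : ∀ σ → ap (∂ₗ X) (ap (at Y) (ap hM x)) σ ≈ z σ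
        bdry σ = begin
          ap (∂ₗ X) (ap (at Y) (ap hM x)) σ  ≈⟨ ∂-at Y-full X (ap hM x) σ ⟩
          ap D (ap hM x) (σ ++ Y)            ≈⟨ proj₂ M (σ ++ Y) ⟩
          x (σ ++ Y)                         ≈⟨ ∸-zeroʳ (proj₁ U (σ ++ Y) λ co → co (full-indep σ Y-full)) ⟩
          z′ (σ ++ Y)                        ≈⟨ extend-on (const? true) z σ Y-full ⟩
          z σ                                ∎

-- Maximal faces and minimal non-faces

allFin⁻ : ∀ {n} {p : Fin n → Bool} → allFin p ≡ true → ∀ i → p i ≡ true
allFin⁻ e zero    = proj₁ (∧-true⁻ e)
allFin⁻ {p = p} e (suc i) = allFin⁻ (proj₂ (∧-true⁻ {p zero} e)) i

allFin⁺ : ∀ {n} {p : Fin n → Bool} → (∀ i → p i ≡ true) → allFin p ≡ true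
allFin⁺ {zero}  h = ≡.refl
allFin⁺ {suc n} h = cong₂ _∧_ (h zero) (allFin⁺ (h ∘ suc))

anyFin⁻ : ∀ {n} {p : Fin n → Bool} → anyFin p ≡ true → ∃ λ i → p i ≡ true
anyFin⁻ {suc n} {p} e with p zero in p₀
... | true  = zero , p₀
... | false = let (i , pi) = anyFin⁻ e in suc i , pi

anyFin⁺ : ∀ {n} {p : Fin n → Bool} i → p i ≡ true → anyFin p ≡ true
anyFin⁺ zero    pi rewrite pi = ≡.refl
anyFin⁺ {p = p} (suc i) pi with p zero
... | true  = ≡.refl
... | false = anyFin⁺ i pi

implies⁻ : ∀ {a b} → not a ∨ b ≡ true → a ≡ true → b ≡ true
implies⁻ {true} e ≡.refl = e

implies⁺ : ∀ {a b} → (a ≡ true → b ≡ true) → not a ∨ b ≡ true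
implies⁺ {true}  h = h ≡.refl
implies⁺ {false} h = ≡.refl

subsetB⁻ : ∀ {n} {σ τ : Subset n} → subsetB σ τ ≡ true → σ ⊑ τ
subsetB⁻ e i = implies⁻ (allFin⁻ e i)

subsetB⁺ : ∀ {n} {σ τ : Subset n} → σ ⊑ τ → subsetB σ τ ≡ true
subsetB⁺ h = allFin⁺ λ i → implies⁺ (h i)

⊑-refl : ∀ {n} {σ : Subset n} → σ ⊑ σ
⊑-refl i e = e

⊑-trans : ∀ {n} {σ τ ρ : Subset n} → σ ⊑ τ → τ ⊑ ρ → σ ⊑ ρ
⊑-trans h g i = g i ∘ h i

⊑⇒∣∣≤ : ∀ {n} {σ τ : Subset n} → σ ⊑ τ → ∣ σ ∣ ≤ ∣ τ ∣
⊑⇒∣∣≤ {σ = []}        {[]}        h = z≤n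
⊑⇒∣∣≤ {σ = true ∷ σ}  {true ∷ τ}  h = s≤s (⊑⇒∣∣≤ (h ∘ suc))
⊑⇒∣∣≤ {σ = true ∷ σ}  {false ∷ τ} h with () ← h zero ≡.refl
⊑⇒∣∣≤ {σ = false ∷ σ} {true ∷ τ}  h = ℕP.m≤n⇒m≤1+n (⊑⇒∣∣≤ (h ∘ suc))
⊑⇒∣∣≤ {σ = false ∷ σ} {false ∷ τ} h = ⊑⇒∣∣≤ (h ∘ suc)

⊏⇒∣∣< : ∀ {n} {σ τ : Subset n} → σ ⊑ τ → ¬ τ ⊑ σ → ∣ σ ∣ < ∣ τ ∣
⊏⇒∣∣< {σ = []}        {[]}        h ¬g = contradiction (λ ()) ¬g
⊏⇒∣∣< {σ = true ∷ σ}  {true ∷ τ}  h ¬g = s≤s (⊏⇒∣∣< (h ∘ suc) λ g → ¬g λ { zero e → e ; (suc i) → g i })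
⊏⇒∣∣< {σ = true ∷ σ}  {false ∷ τ} h ¬g with () ← h zero ≡.refl
⊏⇒∣∣< {σ = false ∷ σ} {true ∷ τ}  h ¬g = s≤s (⊑⇒∣∣≤ (h ∘ suc))
⊏⇒∣∣< {σ = false ∷ σ} {false ∷ τ} h ¬g = ⊏⇒∣∣< (h ∘ suc) λ g → ¬g λ { zero e → e ; (suc i) → g i }

∈-allSubsets : ∀ {n} (σ : Subset n) → σ ∈ allSubsets n
∈-allSubsets []          = here ≡.refl
∈-allSubsets (false ∷ σ) = ∈-++⁺ˡ (∈-map⁺ (false ∷_) (∈-allSubsets σ))
∈-allSubsets (true ∷ σ)  = ∈-++⁺ʳ _ (∈-map⁺ (true ∷_) (∈-allSubsets σ))

allList-false : ∀ {A : Set} {p : A → Bool} xs → allList p xs ≡ false → ∃ λ x → p x ≡ false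
allList-false {p = p} (x ∷ xs) e with p x in px
... | false = x , px
... | true  = allList-false xs e

false-implies : ∀ {a b} → not a ∨ b ≡ false → a ≡ true × b ≡ false
false-implies {true} e = ≡.refl , e

selected : ∀ {n} (p : Subset n → Bool) → List (Subset n)
selected {n} p = filter (λ s → p s ≟ᵇ true) (allSubsets n)

selected-lookup : ∀ {n} (p : Subset n → Bool) w → p (lookup (selected p) w) ≡ true
selected-lookup {n} p w = proj₂ (∈-filter⁻ (λ s → p s ≟ᵇ true) {xs = allSubsets n} (∈-lookup {xs = selected p} w))

selected-index : ∀ {n} (p : Subset n → Bool) {σ} → p σ ≡ true → ∃ λ w → σ ≡ lookup (selected p) w
selected-index p {σ} e = let i = ∈-filter⁺ (λ s → p s ≟ᵇ true) (∈-allSubsets σ) e in index i , lookup-index i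

module _ {n : ℕ} (K : Complex n) where

  -- A failed maximality test exhibits a strictly larger face to continue with; `f` bounds how often
  -- the cardinality can still grow within n vertices.
  below-maximal : ∀ f σ → n ≤ f + ∣ σ ∣ → face K σ ≡ true → ∃ λ τ → isMaximalFace K τ ≡ true × σ ⊑ τ
  below-maximal f σ fuel fσ
    with allList (λ τ → not (face K τ ∧ subsetB σ τ) ∨ eqB τ σ) (allSubsets n) in eq
  ... | true  = σ , cong₂ _∧_ fσ eq , ⊑-refl
  ... | false with allList-false (allSubsets n) eq
  ... | τ , e with false-implies {face K τ ∧ subsetB σ τ} e
  ... | fτ∧σ⊑τ , ≢σ with ∧-true⁻ {face K τ} fτ∧σ⊑τ
  ... | fτ , sub = recurse f fuel
    where
    σ⊑τ = subsetB⁻ {σ = σ} {τ} sub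
    grows : ∣ σ ∣ < ∣ τ ∣
    grows = ⊏⇒∣∣< σ⊑τ λ τ⊑σ → true≢false (cong₂ _∧_ (subsetB⁺ τ⊑σ) sub) ≢σ
    recurse : ∀ f → n ≤ f + ∣ σ ∣ → ∃ λ τ → isMaximalFace K τ ≡ true × σ ⊑ τ
    recurse zero    fuel = contradiction (ℕP.<-≤-trans (ℕP.≤-<-trans fuel grows) (∣p∣≤n τ)) (ℕP.<-irrefl ≡.refl)
    recurse (suc f) fuel =
      let (ρ , max , τ⊑ρ) = below-maximal f τ
            (ℕP.≤-trans fuel (ℕP.≤-trans (ℕP.≤-reflexive (≡.sym (ℕP.+-suc f ∣ σ ∣))) (ℕP.+-monoʳ-≤ f grows))) fτ
      in ρ , max , ⊑-trans σ⊑τ τ⊑ρ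

  above-minimal : ∀ f σ → ∣ σ ∣ ≤ f → face K σ ≡ false → ∃ λ τ → isMinimalNonFace K τ ≡ true × τ ⊑ σ
  above-minimal f σ fuel fσ
    with allList (λ τ → not (subsetB τ σ ∧ not (eqB τ σ)) ∨ face K τ) (allSubsets n) in eq
  ... | true  = σ , cong₂ _∧_ (cong not fσ) eq , ⊑-refl
  ... | false with allList-false (allSubsets n) eq
  ... | τ , e with false-implies {subsetB τ σ ∧ not (eqB τ σ)} e
  ... | τ⊏σ , fτ with ∧-true⁻ {subsetB τ σ} τ⊏σ
  ... | sub , ≢σ = recurse f fuel
    where
    τ⊑σ = subsetB⁻ {σ = τ} {σ} sub
    shrinks : ∣ τ ∣ < ∣ σ ∣
    shrinks = ⊏⇒∣∣< τ⊑σ λ σ⊑τ → true≢false ≢σ (cong not (cong₂ _∧_ sub (subsetB⁺ σ⊑τ)))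
    recurse : ∀ f → ∣ σ ∣ ≤ f → ∃ λ τ → isMinimalNonFace K τ ≡ true × τ ⊑ σ
    recurse zero    fuel with () ← ℕP.<-≤-trans shrinks fuel
    recurse (suc f) fuel =
      let (ρ , min , ρ⊑τ) = above-minimal f τ (s≤s⁻¹ (ℕP.<-≤-trans shrinks fuel)) fτ
      in ρ , min , ⊑-trans ρ⊑τ τ⊑σ

-- The three bounds

module Main {c ℓ : Level} (F : Field c ℓ) where
  open Homology F
  open Bounds F
  open Transfer F

  module _ (r : ℚ.ℚ) (above : AboveΓ r) where

    cover-bound : ∀ n m (e : Fin n → Fin m → Bool) (K : Subset n → Set) →
      (∀ σ → K σ → ∃ λ w → ∀ x → memb x σ ≡ true → e x w ≡ false) →
      (∀ σ w → (∀ x → memb x σ ≡ true → e x w ≡ false) → K σ) →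
      ∃ λ k → fromℕ k ℚ.≤ powℚ r (n + m) × Bound K k
    cover-bound zero    m e K K⇒ ⇒K = 1 , Numbers.1≤pow r above m , bound-point
    cover-bound (suc n) m e K K⇒ ⇒K =
      let open Bipartite e
          (k , small , bd) = MatchingTree.independent-bound edge edge-sym edge-irrefl edge-triangle-free rules-up r above
      in k , small , bound-cover e K K⇒ ⇒K (cone-bound rules-up m ℕP.≤-refl) bd

    transversal-bound : ∀ n m (e : Fin n → Fin m → Bool) (K : Subset n → Set) →
      (∀ σ → K σ → ∀ w → ¬ (∀ x → memb x σ ≡ false → e x w ≡ false)) →
      (∀ σ → (∀ w → ¬ (∀ x → memb x σ ≡ false → e x w ≡ false)) → K σ) →
      ∃ λ k → fromℕ k ℚ.≤ powℚ r (n + m) × Bound K k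
    transversal-bound zero    m e K K⇒ ⇒K = 1 , Numbers.1≤pow r above m , bound-point
    transversal-bound (suc n) m e K K⇒ ⇒K =
      let open Bipartite e
          (k , small , bd) = MatchingTree.independent-bound edge edge-sym edge-irrefl edge-triangle-free rules-down r above
      in k , small , bound-transversal e K K⇒ ⇒K (cone-bound rules-down m ℕP.≤-refl) bd

    betti-bound : ∀ {n} {K : Complex n} {b N} → TotalBetti K b →
      (∃ λ k → fromℕ k ℚ.≤ powℚ r N × Bound (IsFace K) k) → fromℕ b ℚ.≤ powℚ r N
    betti-bound {K = K} tb (k , small , bd) = ℚP.≤-trans (fromℕ-mono (totalBetti≤ {K = K} tb bd)) small

  maximal-faces : ∀ n (K : Complex n) b → TotalBetti K b → b ≤Γ^ (n + numMaximalFaces K)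
  maximal-faces n K b tb r above = betti-bound r above {K = K} {N = n + numMaximalFaces K} tb
    (cover-bound r above n (numMaximalFaces K) e (IsFace K) faces⇒ ⇒faces)
    where
    facet : Fin (numMaximalFaces K) → Subset n
    facet = lookup (selected (isMaximalFace K))
    e : Fin n → Fin (numMaximalFaces K) → Bool
    -- Non-incidence: a set has no neighbour of `w` exactly if it lies in the facet `w`.
    e x w = not (memb x (facet w))
    faces⇒ : ∀ σ → IsFace K σ → ∃ λ w → ∀ x → memb x σ ≡ true → e x w ≡ false
    faces⇒ σ fσ with below-maximal K n σ (ℕP.m≤m+n n ∣ σ ∣) fσ
    ... | τ , max , σ⊑τ with selected-index (isMaximalFace K) max
    ... | w , ≡.refl = w , λ x mx → cong not (σ⊑τ x mx)
    ⇒faces : ∀ σ w → (∀ x → memb x σ ≡ true → e x w ≡ false) → IsFace K σ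
    ⇒faces σ w h = downward K σ (facet w)
      (subsetB⁺ λ x mx → ≡.trans (≡.sym (not-involutive _)) (cong not (h x mx)))
      (proj₁ (∧-true⁻ (selected-lookup (isMaximalFace K) w)))

  neighbourhoods : ∀ n (G : Graph n) b → TotalBetti (neighbourhoodComplex G) b → b ≤Γ²^ n
  neighbourhoods n G b tb r above = subst (fromℕ b ℚ.≤_) (≡.sym (powℚ-square r n))
    (betti-bound r above {K = neighbourhoodComplex G} {N = n + n} tb
      -- Vertices of the graph label both sides, whence n + n and the square of Γ. The simplices of
      -- the cover are the neighbourhoods of the vertices w.
      (cover-bound r above n n (λ x w → not (adj G x w)) (IsFace (neighbourhoodComplex G))
        (λ σ fσ → let (w , nb) = anyFin⁻ fσ in w , λ x mx → cong not (implies⁻ (allFin⁻ nb x) mx))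
        (λ σ w h → anyFin⁺ w (allFin⁺ λ x → implies⁺ λ mx → ≡.trans (≡.sym (not-involutive _)) (cong not (h x mx))))))

  minimal-nonfaces : ∀ n (K : Complex n) b → TotalBetti K b → b ≤Γ^ (n + numMinimalNonFaces K)
  minimal-nonfaces n K b tb r above = betti-bound r above {K = K} {N = n + numMinimalNonFaces K} tb
    (transversal-bound r above n (numMinimalNonFaces K) e (IsFace K) faces⇒ ⇒faces)
    where
    nonface : Fin (numMinimalNonFaces K) → Subset n
    nonface = lookup (selected (isMinimalNonFace K))
    e : Fin n → Fin (numMinimalNonFaces K) → Bool
    -- Incidence this time: a set is a face exactly if its complement meets every minimal non-face.
    e x w = memb x (nonface w)
    faces⇒ : ∀ σ → IsFace K σ → ∀ w → ¬ (∀ x → memb x σ ≡ false → e x w ≡ false)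
    faces⇒ σ fσ w h = true≢false
      (downward K (nonface w) σ
        (subsetB⁺ λ x mw → decide x (memb x σ ≟ᵇ true) mw) fσ)
      (≡.trans (≡.sym (not-involutive _)) (cong not (proj₁ (∧-true⁻ (selected-lookup (isMinimalNonFace K) w)))))
      where
      decide : ∀ x → Dec (memb x σ ≡ true) → memb x (nonface w) ≡ true → memb x σ ≡ true
      decide x (yes m) _  = m
      decide x (no ¬m) mw = contradiction (h x (¬-not ¬m)) (true≢false mw)
    ⇒faces : ∀ σ → (∀ w → ¬ (∀ x → memb x σ ≡ false → e x w ≡ false)) → IsFace K σ
    ⇒faces σ h with face K σ in fσ
    ... | true  = ≡.refl
    ... | false with above-minimal K ∣ σ ∣ σ ℕP.≤-refl fσ
    ... | τ , min , τ⊑σ with selected-index (isMinimalNonFace K) min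
    ... | w , ≡.refl = contradiction (λ x mx → ¬-not λ mw → true≢false (τ⊑σ x mw) mx) (h w)

theorem1p2 : ∀ {c ℓ} (F : Field c ℓ) → let open Homology F in
    (∀ (n : ℕ) (K : Complex n) → HasVertexSet K →
       ∀ b → TotalBetti K b → b ≤Γ^ (n + numMaximalFaces K))
    × (∀ (n : ℕ) (G : Graph n) →
       ∀ b → TotalBetti (neighbourhoodComplex G) b → b ≤Γ²^ n)
    × (∀ (n : ℕ) (K : Complex n) → HasVertexSet K →
       ∀ b → TotalBetti K b → b ≤Γ^ (n + numMinimalNonFaces K))
theorem1p2 F = (λ n K _ → maximal-faces n K) , neighbourhoods , (λ n K _ → minimal-nonfaces n K)
  where open Main F
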